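{- Let $n$ be an odd prime, let $p$ be a prime, let $r$ be a positive integer, and let $d=p^r$. Then there is at most one pair $(x,y)$ of positive integers with $\gcd(x,y)=1$ satisfying $$(x-d)^2+x^2+(x+d)^2=y^n.$$ -}

module Defs where

open import Data.Nat as ℕ using (ℕ)
open import Data.Nat.GCD using (gcd)
open import Data.Integer as ℤ using (ℤ; +_; _-_; _+_; _*_; _^_)
open import Relation.Binary.PropositionalEquality using (_≡_)
open import Data.Product using (_×_)

IsSolution : (n d x y : ℕ) → Set
IsSolution n d x y =
  (0 ℕ.< x) × (0 ℕ.< y) × (gcd x y ≡ 1) ×
  (((+ x - + d) ^ 2) + ((+ x) ^ 2) + ((+ x + + d) ^ 2) ≡ (+ y) ^ n)

{-# OPTIONS --safe #-}

-- The equation reads 3x² + 2d² = yⁿ. Reduction of forms of discriminant -24 gives y = 3u² + 2v²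
-- (2y is excluded modulo 3), and uniqueness of roots of 3t² + 2 modulo yⁿ then gives
-- x√3 + d√-2 = ±(u√3 + v√-2)ⁿ. Hence d = vL with L a polynomial in p = 3u² and q = 2v².
-- For d a power of a prime ℓ the value of v² is forced. Indeed L is odd, so L = ±1 if ℓ = 2; if
-- ℓ = n, Frobenius gives n ∣ v, and L ≡ n pᵐ (mod q), n = 2m + 1, shows that n divides L exactly
-- once; otherwise L = ±1 or v = ±1, and L = -1 is impossible modulo 3 while L = 1 is impossible
-- 2-adically. Finally, for fixed q, a 2-adic estimate of the difference quotient of L shows that
-- L determines p.
module Submission where

open import Defs
import Algebra.Definitions
import Algebra.Properties.AbelianGroup
import Algebra.Properties.CommutativeSemiring.Binomial
import Algebra.Properties.Semiring.Exp
import Algebra.Properties.Semiring.Mult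
import Algebra.Properties.Semiring.Sum
import Algebra.Structures
import Algebra.Structures.Biased
open import Algebra.Bundles using (CommutativeSemiring)
open import Data.Empty using (⊥; ⊥-elim)
open import Data.Fin using (Fin; zero; suc; inject₁; fromℕ; toℕ)
import Data.Fin.Properties as Fin
open import Data.Integer using (ℤ; +_; -[1+_]; -_; _+_; _-_; _*_; 0ℤ; 1ℤ; ≢-nonZero)
  renaming (_^_ to _^ℤ_; ∣_∣ to abs)
open import Data.Integer.DivMod using (_%ℕ_; _/ℕ_; n%ℕd<d; a≡a%ℕn+[a/ℕn]*n)
open import Data.Integer.Divisibility.Signed
import Data.Integer.Properties as ℤ
open import Data.Integer.Tactic.RingSolver using (solve-∀)
open import Data.Nat using (ℕ; _<_; _^_)
open import Data.Nat as ℕ using (zero; suc; _!)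
open import Data.Nat.Combinatorics using (_C_; nCk≡n!/k![n-k]!; k![n∸k]!∣n!)
import Data.Nat.Divisibility as ℕ
open import Data.Nat.DivMod using (m/n*n≡m)
open import Data.Nat.GCD using (GCD; gcd; gcd-GCD; module Bézout)
open import Data.Nat.Induction using (<-rec)
open import Data.Nat.Primality
  using (Prime; prime?; euclidsLemma; prime⇒nonTrivial; prime⇒nonZero; prime⇒irreducible)
import Data.Nat.Properties as ℕ
open import Data.Nat.Properties using (_!*_!≢0)
open import Data.Product using (_×_; _,_; proj₁; proj₂; ∃)
open import Data.Sum using (_⊎_; inj₁; inj₂; [_,_]′) renaming (map to ⊎-map)
open import Function using (id)
open import Level using (0ℓ)
open import Relation.Binary.PropositionalEquality
open import Relation.Nullary using (¬_; contradiction; yes; no)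
open import Relation.Nullary.Decidable using (from-yes)

-- The ring of integers of `ℚ(√-6)` has class number 2, so an `n`-th root of `x√3 + d√-2` cannot be
-- extracted by unique factorisation. Instead two elements of norm `yⁿ` are compared: write
-- `X√3 + Y√-2` for `(u√3 + v√-2)ⁿ`. The ratios `x / d` and `X / Y` agree modulo `y`. As
-- `3(xY + Xd)(xY - Xd)` is a multiple of `yⁿ`, and `3(xY + Xd)` is invertible modulo `y`, the cross
-- term `xY - Xd` is a multiple of `yⁿ`. Since `6(xY - Xd)²` plus a square is `y²ⁿ`, the cross term
-- is 0.
--
-- No fixed power of 2 suffices for the 2-adic steps, because `m` may be divisible by any power of
-- 2. With `E` the largest power of 2 dividing `m`, `L - 1` is `2E` times an odd number (for odd `u`
-- and `v`), and `L(p₁) - L(p₂)` is `(p₁ - p₂) E` times an odd number. Both facts pass from `m` to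
-- `2m`, and odd `m` is the base case.

-- Prime divisors of binomial coefficients.

prime∤! : ∀ {p} → Prime p → ∀ k → k ℕ.< p → ¬ p ℕ.∣ k !
prime∤! pr zero k<p p∣1 = ℕ.>⇒∤ (ℕ.nonTrivial⇒n>1 _ {{prime⇒nonTrivial pr}}) p∣1
prime∤! pr (suc k) k<p p∣ with euclidsLemma (suc k) (k !) pr p∣
... | inj₁ p∣k = ℕ.>⇒∤ k<p p∣k
... | inj₂ p∣k! = prime∤! pr k (ℕ.<-trans (ℕ.n<1+n k) k<p) p∣k!

prime∣nCk : ∀ {p k} → Prime p → 0 ℕ.< k → k ℕ.< p → p ℕ.∣ p C k
prime∣nCk {p} {k} pr 0<k k<p with euclidsLemma (p C k) (k ! ℕ.* (p ℕ.∸ k) !) pr p∣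
  where
  p∣p! : ∀ {p} → 0 ℕ.< p → p ℕ.∣ p !
  p∣p! {suc p} _ = ℕ.m∣m*n (p !)
  p∣ : p ℕ.∣ (p C k) ℕ.* (k ! ℕ.* (p ℕ.∸ k) !)
  p∣ = subst (p ℕ.∣_)
    (sym (trans (cong (ℕ._* (k ! ℕ.* (p ℕ.∸ k) !)) (nCk≡n!/k![n-k]! (ℕ.<⇒≤ k<p)))
                (m/n*n≡m {{k !* (p ℕ.∸ k) !≢0}} (k![n∸k]!∣n! (ℕ.<⇒≤ k<p)))))
    (p∣p! (ℕ.<-trans 0<k k<p))
... | inj₁ p∣C = p∣C
... | inj₂ p∣k!l! with euclidsLemma (k !) ((p ℕ.∸ k) !) pr p∣k!l!
...   | inj₁ p∣k! = contradiction p∣k! (prime∤! pr k k<p)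
...   | inj₂ p∣l! = contradiction p∣l! (prime∤! pr (p ℕ.∸ k) (ℕ.∸-monoʳ-< 0<k (ℕ.<⇒≤ k<p)))

-- The ring `ℤ[√D]` and its Frobenius congruence.

module Quadratic (D : ℤ) where

  infixl 6 _⊕_
  infixl 7 _⊗_

  _⊕_ _⊗_ : ℤ × ℤ → ℤ × ℤ → ℤ × ℤ
  (a , b) ⊕ (a′ , b′) = a + a′ , b + b′
  (a , b) ⊗ (a′ , b′) = a * a′ + D * (b * b′) , a * b′ + b * a′

  ⊕-assoc : ∀ x y z → (x ⊕ y) ⊕ z ≡ x ⊕ (y ⊕ z)
  ⊕-assoc (a , b) (a′ , b′) (a″ , b″) =
    cong₂ _,_ (ℤ.+-assoc a a′ a″) (ℤ.+-assoc b b′ b″)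

  ⊕-comm : ∀ x y → x ⊕ y ≡ y ⊕ x
  ⊕-comm (a , b) (a′ , b′) = cong₂ _,_ (ℤ.+-comm a a′) (ℤ.+-comm b b′)

  ⊕-identityˡ : ∀ x → (0ℤ , 0ℤ) ⊕ x ≡ x
  ⊕-identityˡ (a , b) = cong₂ _,_ (ℤ.+-identityˡ a) (ℤ.+-identityˡ b)

  ⊗-assoc : ∀ x y z → (x ⊗ y) ⊗ z ≡ x ⊗ (y ⊗ z)
  ⊗-assoc (a , b) (a′ , b′) (a″ , b″) =
    cong₂ _,_ (re D a b a′ b′ a″ b″) (im D a b a′ b′ a″ b″)
    where
    re : ∀ D a b a′ b′ a″ b″ →
         (a * a′ + D * (b * b′)) * a″ + D * ((a * b′ + b * a′) * b″)
         ≡ a * (a′ * a″ + D * (b′ * b″)) + D * (b * (a′ * b″ + b′ * a″))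
    re = solve-∀
    im : ∀ D a b a′ b′ a″ b″ →
         (a * a′ + D * (b * b′)) * b″ + (a * b′ + b * a′) * a″
         ≡ a * (a′ * b″ + b′ * a″) + b * (a′ * a″ + D * (b′ * b″))
    im = solve-∀

  ⊗-comm : ∀ x y → x ⊗ y ≡ y ⊗ x
  ⊗-comm (a , b) (a′ , b′) = cong₂ _,_ (re D a b a′ b′) (im a b a′ b′)
    where
    re : ∀ D a b a′ b′ → a * a′ + D * (b * b′) ≡ a′ * a + D * (b′ * b)
    re = solve-∀
    im : ∀ a b a′ b′ → a * b′ + b * a′ ≡ a′ * b + b′ * a
    im = solve-∀

  ⊗-identityˡ : ∀ x → (1ℤ , 0ℤ) ⊗ x ≡ x
  ⊗-identityˡ (a , b) = cong₂ _,_ (re D a b) (im a b)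
    where
    re : ∀ D a b → 1ℤ * a + D * (0ℤ * b) ≡ a
    re = solve-∀
    im : ∀ a b → 1ℤ * b + 0ℤ * a ≡ b
    im = solve-∀

  ⊗-distribʳ-⊕ : ∀ x y z → (y ⊕ z) ⊗ x ≡ y ⊗ x ⊕ z ⊗ x
  ⊗-distribʳ-⊕ (a , b) (a′ , b′) (a″ , b″) =
    cong₂ _,_ (re D a b a′ b′ a″ b″) (im a b a′ b′ a″ b″)
    where
    re : ∀ D a b a′ b′ a″ b″ →
         (a′ + a″) * a + D * ((b′ + b″) * b)
         ≡ a′ * a + D * (b′ * b) + (a″ * a + D * (b″ * b))
    re = solve-∀
    im : ∀ a b a′ b′ a″ b″ →
         (a′ + a″) * b + (b′ + b″) * a ≡ a′ * b + b′ * a + (a″ * b + b″ * a)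
    im = solve-∀

  ⊗-zeroˡ : ∀ x → (0ℤ , 0ℤ) ⊗ x ≡ (0ℤ , 0ℤ)
  ⊗-zeroˡ (a , b) = cong₂ _,_ (re D a b) (im a b)
    where
    re : ∀ D a b → 0ℤ * a + D * (0ℤ * b) ≡ 0ℤ
    re = solve-∀
    im : ∀ a b → 0ℤ * b + 0ℤ * a ≡ 0ℤ
    im = solve-∀

  open Algebra.Definitions {A = ℤ × ℤ} _≡_
  open Algebra.Structures {A = ℤ × ℤ} _≡_ using (IsCommutativeMonoid)
  open Algebra.Structures.Biased {A = ℤ × ℤ} _≡_
    using (isCommutativeMonoidˡ; isCommutativeSemiringˡ)

  isCommutativeMonoid : ∀ _∙_ e → Associative _∙_ → LeftIdentity e _∙_ →
                        Commutative _∙_ → IsCommutativeMonoid _∙_ e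
  isCommutativeMonoid _∙_ e assoc identityˡ comm = isCommutativeMonoidˡ record
    { isSemigroup = record
      { isMagma = record { isEquivalence = isEquivalence ; ∙-cong = cong₂ _∙_ }
      ; assoc   = assoc
      }
    ; identityˡ = identityˡ
    ; comm      = comm
    }

  -- This structure makes powers and the binomial theorem available for pairs.
  ℤ[√D] : CommutativeSemiring 0ℓ 0ℓ
  ℤ[√D] = record
    { isCommutativeSemiring = isCommutativeSemiringˡ record
      { +-isCommutativeMonoid = isCommutativeMonoid _⊕_ (0ℤ , 0ℤ) ⊕-assoc ⊕-identityˡ ⊕-comm
      ; *-isCommutativeMonoid = isCommutativeMonoid _⊗_ (1ℤ , 0ℤ) ⊗-assoc ⊗-identityˡ ⊗-comm
      ; distribʳ              = ⊗-distribʳ-⊕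
      ; zeroˡ                 = ⊗-zeroˡ
      }
    }

  private semiring = CommutativeSemiring.semiring ℤ[√D]
  open Algebra.Properties.Semiring.Exp semiring public
    using (^-homo-*) renaming (_^_ to _^^_)
  open Algebra.Properties.Semiring.Mult semiring using () renaming (_×_ to _·_)
  open Algebra.Properties.Semiring.Sum semiring using (sum; sum-init-last)
  open Algebra.Properties.CommutativeSemiring.Binomial ℤ[√D]
    using (binomial; binomialTerm) renaming (theorem to binomialTheorem)

  ·-scale : ∀ k x → k · x ≡ (+ k * proj₁ x , + k * proj₂ x)
  ·-scale zero    (a , b) = refl
  ·-scale (suc k) (a , b) = trans (cong ((a , b) ⊕_) (·-scale k (a , b)))
    (cong₂ _,_ (step (+ k) a) (step (+ k) b))
    where
    step : ∀ k a → a + k * a ≡ (1ℤ + k) * a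
    step = solve-∀

  ∣im-sum : ∀ {k n} (t : Fin n → ℤ × ℤ) → (∀ i → k ∣ proj₂ (t i)) → k ∣ proj₂ (sum t)
  ∣im-sum {n = zero}  t h = divides 0ℤ refl
  ∣im-sum {n = suc n} t h = ∣m∣n⇒∣m+n (h zero) (∣im-sum (λ i → t (suc i)) (λ i → h (suc i)))

  re^ : ∀ a k → (a , 0ℤ) ^^ k ≡ (a ^ℤ k , 0ℤ)
  re^ a zero    = refl
  re^ a (suc k) = trans (cong ((a , 0ℤ) ⊗_) (re^ a k)) (cong₂ _,_ (re D a (a ^ℤ k)) (im a (a ^ℤ k)))
    where
    re : ∀ D a z → a * z + D * (0ℤ * 0ℤ) ≡ a * z
    re = solve-∀
    im : ∀ a z → a * 0ℤ + 0ℤ * z ≡ 0ℤ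
    im = solve-∀

  im^ : ∀ b m → (0ℤ , b) ^^ suc (m ℕ.* 2) ≡ (0ℤ , b ^ℤ suc (m ℕ.* 2) * D ^ℤ m)
  im^ b zero    = cong₂ _,_ (re D b) (im b)
    where
    re : ∀ D b → 0ℤ * 1ℤ + D * (b * 0ℤ) ≡ 0ℤ
    re = solve-∀
    im : ∀ b → 0ℤ * 0ℤ + b * 1ℤ ≡ b * 1ℤ * 1ℤ
    im = solve-∀
  im^ b (suc m) = trans (cong (λ w → (0ℤ , b) ⊗ ((0ℤ , b) ⊗ w)) (im^ b m))
    (cong₂ _,_ (re D b (b ^ℤ (m ℕ.* 2)) (D ^ℤ m)) (im D b (b ^ℤ (m ℕ.* 2)) (D ^ℤ m)))
    where
    re : ∀ D b x y → 0ℤ * (0ℤ * 0ℤ + D * (b * (b * x * y))) + D * (b * (0ℤ * (b * x * y) + b * 0ℤ)) ≡ 0ℤ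
    re = solve-∀
    im : ∀ D b x y → 0ℤ * (0ℤ * (b * x * y) + b * 0ℤ) + b * (0ℤ * 0ℤ + D * (b * (b * x * y)))
                     ≡ b * (b * (b * x)) * (D * y)
    im = solve-∀

  -- In the binomial expansion of `(a + b√D)ⁿ` the middle coefficients are divisible by the prime
  -- `n`, the term `aⁿ` has no imaginary part, and `(b√D)ⁿ = bⁿ Dᵐ √D` remains.
  im-frobenius : ∀ a b m → Prime (suc (m ℕ.* 2)) →
    + suc (m ℕ.* 2) ∣ proj₂ ((a , b) ^^ suc (m ℕ.* 2)) - b ^ℤ suc (m ℕ.* 2) * D ^ℤ m
  im-frobenius a b m pr = subst (+ n ∣_) (sym eq)
      (∣im-sum (λ i → t (suc (inject₁ i))) middle)
    where
    n = suc (m ℕ.* 2)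
    t = binomialTerm (a , 0ℤ) (0ℤ , b) n
    t′ : Fin n → ℤ × ℤ
    t′ i = t (suc i)
    M = sum (λ i → t′ (inject₁ i))
    expand : (a , b) ^^ n ≡ t zero ⊕ (M ⊕ t′ (fromℕ (m ℕ.* 2)))
    expand = trans (cong (_^^ n) (cong₂ _,_ (sym (ℤ.+-identityʳ a)) (sym (ℤ.+-identityˡ b))))
      (trans (binomialTheorem n (a , 0ℤ) (0ℤ , b)) (cong (t zero ⊕_) (sum-init-last t′)))
    first : proj₂ (t zero) ≡ b ^ℤ n * D ^ℤ m
    first = trans (cong proj₂ (·-scale (n C 0) ((1ℤ , 0ℤ) ⊗ (0ℤ , b) ^^ n)))
      (trans (cong (λ w → + (n C 0) * proj₂ w) (trans (⊗-identityˡ _) (im^ b m)))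
             (ℤ.*-identityˡ _))
    lst : proj₂ (t′ (fromℕ (m ℕ.* 2))) ≡ 0ℤ
    lst = begin
      proj₂ (t (suc top))
        ≡⟨ cong proj₂ (·-scale (n C suc (toℕ top)) _) ⟩
      + (n C suc (toℕ top)) * proj₂ ((a , 0ℤ) ^^ suc (toℕ top) ⊗ (0ℤ , b) ^^ (m ℕ.* 2 ℕ.∸ toℕ top))
        ≡⟨ cong (λ k → + (n C suc k) * proj₂ ((a , 0ℤ) ^^ suc k ⊗ (0ℤ , b) ^^ (m ℕ.* 2 ℕ.∸ k)))
                (Fin.toℕ-fromℕ (m ℕ.* 2)) ⟩
      + (n C n) * proj₂ ((a , 0ℤ) ^^ n ⊗ (0ℤ , b) ^^ (m ℕ.* 2 ℕ.∸ m ℕ.* 2))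
        ≡⟨ cong₂ (λ k w → + (n C n) * proj₂ (w ⊗ (0ℤ , b) ^^ k)) (ℕ.n∸n≡0 (m ℕ.* 2)) (re^ a n) ⟩
      + (n C n) * (a ^ℤ n * 0ℤ + 0ℤ * 1ℤ)
        ≡⟨ zeros (+ (n C n)) (a ^ℤ n) ⟩
      0ℤ ∎
      where
      open ≡-Reasoning
      top = fromℕ (m ℕ.* 2)
      zeros : ∀ x y → x * (y * 0ℤ + 0ℤ * 1ℤ) ≡ 0ℤ
      zeros = solve-∀
    eq : proj₂ ((a , b) ^^ n) - b ^ℤ n * D ^ℤ m ≡ proj₂ M
    eq = trans (cong (_- b ^ℤ n * D ^ℤ m) (trans (cong proj₂ expand)
           (cong₂ _+_ first (cong (λ z → proj₂ M + z) lst))))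
           (cancel (b ^ℤ n * D ^ℤ m) (proj₂ M))
      where
      cancel : ∀ x y → x + (y + 0ℤ) - x ≡ y
      cancel = solve-∀
    middle : ∀ i → + n ∣ proj₂ (t′ (inject₁ i))
    middle i = subst (+ n ∣_) (sym (cong proj₂ (·-scale (n C k) w)))
      (∣m⇒∣m*n {+ n} {+ (n C k)} (proj₂ w) (∣ᵤ⇒∣ (prime∣nCk pr (ℕ.s≤s ℕ.z≤n)
        (ℕ.s≤s (subst (ℕ._< m ℕ.* 2) (sym (Fin.toℕ-inject₁ i)) (Fin.toℕ<n i))))))
      where
      k = suc (toℕ (inject₁ i))
      w = binomial (a , 0ℤ) (0ℤ , b) n (suc (inject₁ i))

∣-lin₁ : ∀ {k z} s {a} → k ∣ a → z ≡ s * a → k ∣ z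
∣-lin₁ s k∣a eq = subst (_ ∣_) (sym eq) (∣n⇒∣m*n s k∣a)

∣-lin₂ : ∀ {k z} s {a} t {b} → k ∣ a → k ∣ b → z ≡ s * a + t * b → k ∣ z
∣-lin₂ s t k∣a k∣b eq =
  subst (_ ∣_) (sym eq) (∣m∣n⇒∣m+n (∣n⇒∣m*n s k∣a) (∣n⇒∣m*n t k∣b))

∣-lin₃ : ∀ {k z} s {a} t {b} u {c} → k ∣ a → k ∣ b → k ∣ c →
         z ≡ s * a + t * b + u * c → k ∣ z
∣-lin₃ s t u k∣a k∣b k∣c eq = subst (_ ∣_) (sym eq)
  (∣m∣n⇒∣m+n (∣m∣n⇒∣m+n (∣n⇒∣m*n s k∣a) (∣n⇒∣m*n t k∣b)) (∣n⇒∣m*n u k∣c))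

-- Powers of `√p + √-q` and their congruences.

-- β = (√p + √-q)² with √D = 2 √p √-q, and (√p + √-q)^(2m+1) = K m √p + L m √-q.
module Lehmer (p q : ℤ) where

  D : ℤ
  D = - (+ 4 * p * q)

  open Quadratic D public

  β : ℤ × ℤ
  β = p - q , 1ℤ

  C S : ℕ → ℤ
  C m = proj₁ (β ^^ m)
  S m = proj₂ (β ^^ m)

  opaque
    K L : ℕ → ℤ
    K m = C m - + 2 * q * S m
    L m = C m + + 2 * p * S m

    L-def : ∀ m → L m ≡ C m + + 2 * p * S m
    L-def m = refl

  β^-double : ∀ m → β ^^ (m ℕ.* 2) ≡ β ^^ m ⊗ β ^^ m
  β^-double m = trans (cong (β ^^_) (trans (ℕ.*-comm m 2) (cong (m ℕ.+_) (ℕ.+-identityʳ m))))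
    (^-homo-* β m m)

  -- The norm of `β` is `(p - q)² + 4pq = (p + q)²`.
  norm : ∀ m → C m * C m - D * (S m * S m) ≡ (p + q) ^ℤ (m ℕ.* 2)
  norm zero    = base D
    where
    base : ∀ D → 1ℤ * 1ℤ - D * (0ℤ * 0ℤ) ≡ 1ℤ
    base = solve-∀
  norm (suc m) = trans (step p q (C m) (S m)) (cong (λ z → (p + q) * ((p + q) * z)) (norm m))
    where
    step : ∀ p q c s →
      ((p - q) * c + - (+ 4 * p * q) * (1ℤ * s)) * ((p - q) * c + - (+ 4 * p * q) * (1ℤ * s))
        - - (+ 4 * p * q) * (((p - q) * s + 1ℤ * c) * ((p - q) * s + 1ℤ * c))
      ≡ (p + q) * ((p + q) * (c * c - - (+ 4 * p * q) * (s * s)))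
    step = solve-∀

  opaque
    unfolding K L

    norm-KL : ∀ m → p * (K m * K m) + q * (L m * L m) ≡ (p + q) ^ℤ suc (m ℕ.* 2)
    norm-KL m = trans (expand p q (C m) (S m)) (cong ((p + q) *_) (norm m))
      where
      expand : ∀ p q c s →
        p * ((c - + 2 * q * s) * (c - + 2 * q * s)) + q * ((c + + 2 * p * s) * (c + + 2 * p * s))
        ≡ (p + q) * (c * c - - (+ 4 * p * q) * (s * s))
      expand = solve-∀

    K≡L : ∀ m → p + q ∣ K m - L m
    K≡L m = divides (- (+ 2 * S m)) (eq p q (C m) (S m))
      where
      eq : ∀ p q c s → (c - + 2 * q * s) - (c + + 2 * p * s) ≡ - (+ 2 * s) * (p + q)
      eq = solve-∀

    -- Modulo `p + q` one has `D ≡ (2p)²`, so `√D ↦ 2p` defines a ring homomorphism. It sends `β` to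
    -- `3p - q` and `βᵐ` to `L m`.
    L-mod-p+q : ∀ m → p + q ∣ L m - (+ 3 * p - q) ^ℤ m
    L-mod-p+q zero = divides 0ℤ (eq p)
      where
      eq : ∀ p → (1ℤ + + 2 * p * 0ℤ) - 1ℤ ≡ 0ℤ
      eq = solve-∀
    L-mod-p+q (suc m) = ∣-lin₂ (+ 3 * p - q) (- (+ 4 * p * S m)) (L-mod-p+q m) ∣-refl
      (eq p q (C m) (S m) ((+ 3 * p - q) ^ℤ m))
      where
      eq : ∀ p q c s z →
        ((p - q) * c + - (+ 4 * p * q) * (1ℤ * s) + + 2 * p * ((p - q) * s + 1ℤ * c)) - (+ 3 * p - q) * z
        ≡ (+ 3 * p - q) * ((c + + 2 * p * s) - z) + - (+ 4 * p * s) * (p + q)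
      eq = solve-∀

  C-mod-q : ∀ m → q ∣ C m - p ^ℤ m
  C-mod-q zero = divides 0ℤ refl
  C-mod-q (suc m) = ∣-lin₂ p (- (C m + + 4 * p * S m)) (C-mod-q m) ∣-refl
    (eq p q (C m) (S m) (p ^ℤ m))
    where
    eq : ∀ p q c s z →
      ((p - q) * c + - (+ 4 * p * q) * (1ℤ * s)) - p * z ≡ p * (c - z) + - (c + + 4 * p * s) * q
    eq = solve-∀

  -- Modulo `q`, `D` vanishes and `βᵐ ≡ (p + √D)ᵐ` has imaginary part `m pᵐ⁻¹`. The extra factor `p`
  -- avoids the exponent `m - 1`.
  pS-mod-q : ∀ m → q ∣ p * S m - + m * p ^ℤ m
  pS-mod-q zero = divides 0ℤ (eq p)
    where
    eq : ∀ p → p * 0ℤ - 0ℤ * 1ℤ ≡ 0ℤ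
    eq = solve-∀
  pS-mod-q (suc m) = ∣-lin₃ p p (- (p * S m)) (pS-mod-q m) (C-mod-q m) ∣-refl
    (eq p q (C m) (S m) (p ^ℤ m) (+ m))
    where
    eq : ∀ p q c s z m →
      p * ((p - q) * s + 1ℤ * c) - (1ℤ + m) * (p * z)
      ≡ p * (p * s - m * z) + p * (c - z) + - (p * s) * q
    eq = solve-∀

  opaque
    unfolding K L

    L-mod-q : ∀ m → q ∣ L m - + suc (m ℕ.* 2) * p ^ℤ m
    L-mod-q m = ∣-lin₂ 1ℤ (+ 2) (C-mod-q m) (pS-mod-q m)
      (trans (cong (λ n → L m - (1ℤ + n) * p ^ℤ m) (ℤ.pos-* m 2)) (eq p (C m) (S m) (p ^ℤ m) (+ m)))
      where
      eq : ∀ p c s z m → (c + + 2 * p * s) - (1ℤ + m * + 2) * z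
                         ≡ 1ℤ * (c - z) + + 2 * (p * s - m * z)
      eq = solve-∀

  -- Here and in `S≡m`, `β ≡ 1 + √D` with `(√D)² ≡ 0` modulo `k`, so `βᵐ ≡ 1 + m√D`.
  C≡1 : ∀ {k} → k ∣ p - q - 1ℤ → k ∣ D → ∀ m → k ∣ C m - 1ℤ
  C≡1 k∣c-1 k∣D zero    = divides 0ℤ refl
  C≡1 k∣c-1 k∣D (suc m) = ∣-lin₃ (p - q) 1ℤ (S m) (C≡1 k∣c-1 k∣D m) k∣c-1 k∣D
    (eq p q D (C m) (S m))
    where
    eq : ∀ p q D c s → ((p - q) * c + D * (1ℤ * s)) - 1ℤ
                       ≡ (p - q) * (c - 1ℤ) + 1ℤ * (p - q - 1ℤ) + s * D
    eq = solve-∀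

  S≡m : ∀ {k} → k ∣ p - q - 1ℤ → k ∣ D → ∀ m → k ∣ S m - + m
  S≡m k∣c-1 k∣D zero    = divides 0ℤ refl
  S≡m k∣c-1 k∣D (suc m) = ∣-lin₃ (p - q) (+ m) 1ℤ (S≡m k∣c-1 k∣D m) k∣c-1 (C≡1 k∣c-1 k∣D m)
    (eq p q (C m) (S m) (+ m))
    where
    eq : ∀ p q c s m → ((p - q) * s + 1ℤ * c) - (1ℤ + m)
                       ≡ (p - q) * (s - m) + m * (p - q - 1ℤ) + 1ℤ * (c - 1ℤ)
    eq = solve-∀

-- The 2-adic valuation of `L m - 1`.

even⊎odd : ∀ m → (∃ λ k → m ≡ k ℕ.* 2) ⊎ (∃ λ k → m ≡ suc (k ℕ.* 2))
even⊎odd zero = inj₁ (0 , refl)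
even⊎odd (suc m) with even⊎odd m
... | inj₁ (k , refl) = inj₂ (k , refl)
... | inj₂ (k , refl) = inj₁ (suc k , refl)

-- Induction on the 2-adic valuation of `m`. Doubling `m` squares `βᵐ`, and there the gain of
-- exactly one factor 2 can be read off.
odd-double-rec : (P : ℕ → Set) → (∀ k → P (suc (k ℕ.* 2))) →
                 (∀ k → P k → P (k ℕ.* 2)) → ∀ m → 0 ℕ.< m → P m
odd-double-rec P odd double = <-rec _ step
  where
  step : ∀ m → (∀ {k} → k ℕ.< m → 0 ℕ.< k → P k) → 0 ℕ.< m → P m
  step m rec 0<m with even⊎odd m
  ... | inj₂ (k , refl)     = odd k
  ... | inj₁ (suc k , refl) = double (suc k)
    (rec (ℕ.m<m*n (suc k) 2 (ℕ.s≤s (ℕ.s≤s ℕ.z≤n))) (ℕ.s≤s ℕ.z≤n))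

1+2k≢0 : ∀ k → 1ℤ + + 2 * k ≢ 0ℤ
1+2k≢0 k eq = 2∤1 (∣⇒∣ᵤ {+ 2} {1ℤ} (divides (- k) (trans (lemma k)
  (trans (cong (_+ - k * + 2) eq) (ℤ.+-identityˡ (- k * + 2))))))
  where
  2∤1 : ¬ 2 ℕ.∣ 1
  2∤1 = ℕ.>⇒∤ (ℕ.s≤s (ℕ.s≤s ℕ.z≤n))
  lemma : ∀ k → 1ℤ ≡ 1ℤ + + 2 * k + - k * + 2
  lemma = solve-∀

*-≢0 : ∀ a b → a ≢ 0ℤ → b ≢ 0ℤ → a * b ≢ 0ℤ
*-≢0 a b a≢0 b≢0 ab≡0 = [ a≢0 , b≢0 ]′ (ℤ.i*j≡0⇒i≡0∨j≡0 a ab≡0)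

module _ {p q : ℤ} where
  open Lehmer p q

  -- For (c , s) = β ^^ m, E is the largest power of 2 dividing m.
  Close : ℤ × ℤ → Set
  Close (c , s) = ∃ λ E → ∃ λ k → ∃ λ l →
    E ≢ 0ℤ × c ≡ 1ℤ + + 4 * E * k × s ≡ E * (1ℤ + + 2 * l)

  -- Squaring gives `c² + D s²` and `2cs`. Here `(1 + 4Ek)²` is 1 modulo `8E`, `8 ∣ D` makes `D s²`
  -- a multiple of `8E²`, and `c` is odd, so `E` becomes `2E` in both coordinates.
  close-square : ∀ w → + 8 ∣ D → Close w → Close (w ⊗ w)
  close-square _ (divides d D≡) (E , k , l , E≢0 , refl , refl) =
    + 2 * E , k + + 2 * E * k * k + d * E * (1ℤ + + 2 * l) * (1ℤ + + 2 * l) ,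
    l + + 2 * E * k * (1ℤ + + 2 * l) ,
    *-≢0 (+ 2) E (λ ()) E≢0 ,
    trans (cong (λ D → (1ℤ + + 4 * E * k) * (1ℤ + + 4 * E * k)
                  + D * (E * (1ℤ + + 2 * l) * (E * (1ℤ + + 2 * l)))) D≡) (re E k l d) ,
    im E k l
    where
    re : ∀ E k l d →
      (1ℤ + + 4 * E * k) * (1ℤ + + 4 * E * k)
        + d * + 8 * (E * (1ℤ + + 2 * l) * (E * (1ℤ + + 2 * l)))
      ≡ 1ℤ + + 4 * (+ 2 * E) * (k + + 2 * E * k * k + d * E * (1ℤ + + 2 * l) * (1ℤ + + 2 * l))
    re = solve-∀
    im : ∀ E k l →
      (1ℤ + + 4 * E * k) * (E * (1ℤ + + 2 * l)) + E * (1ℤ + + 2 * l) * (1ℤ + + 4 * E * k)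
      ≡ + 2 * E * (1ℤ + + 2 * (l + + 2 * E * k * (1ℤ + + 2 * l)))
    im = solve-∀

  close : + 4 ∣ p - q - 1ℤ → + 8 ∣ D → ∀ m → 0 ℕ.< m → Close (β ^^ m)
  close 4∣ 8∣D = odd-double-rec _ odd
    (λ k h → subst Close (sym (β^-double k)) (close-square (β ^^ k) 8∣D h))
    where
    arith : ∀ c s k → + 4 ∣ c - 1ℤ → + 2 ∣ s - (1ℤ + k * + 2) → Close (c , s)
    arith c s k (divides a c≡) (divides b s≡) = 1ℤ , a , b + k , (λ ()) ,
      trans (re c) (trans (cong (λ z → 1ℤ + z) c≡) (re′ a)) ,
      trans (im s k) (trans (cong (λ z → 1ℤ + k * + 2 + z) s≡) (im′ b k))
      where
      re : ∀ c → c ≡ 1ℤ + (c - 1ℤ)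
      re = solve-∀
      re′ : ∀ a → 1ℤ + a * + 4 ≡ 1ℤ + + 4 * 1ℤ * a
      re′ = solve-∀
      im : ∀ s k → s ≡ 1ℤ + k * + 2 + (s - (1ℤ + k * + 2))
      im = solve-∀
      im′ : ∀ b k → 1ℤ + k * + 2 + b * + 2 ≡ 1ℤ * (1ℤ + + 2 * (b + k))
      im′ = solve-∀
    odd : ∀ k → Close (β ^^ suc (k ℕ.* 2))
    odd k = arith (C m) (S m) (+ k)
      (C≡1 4∣ (∣-trans (divides (+ 2) refl) 8∣D) m)
      (subst (λ z → + 2 ∣ S m - z) (cong (λ z → 1ℤ + z) (ℤ.pos-* k 2))
        (S≡m (∣-trans (divides (+ 2) refl) 4∣) (∣-trans (divides (+ 4) refl) 8∣D) m))
      where m = suc (k ℕ.* 2)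

  -- `c - 1` is a multiple of `4E`, while `2ps` is `2E` times an odd number, so their sum is `2E`
  -- times an odd number.
  close⇒≢1 : ∀ c s → + 2 ∣ p - 1ℤ → Close (c , s) → c + + 2 * p * s ≢ 1ℤ
  close⇒≢1 c s (divides p′ p≡) (E , k , l , E≢0 , c≡ , s≡) eq₁ =
    *-≢0 (+ 2 * E) (1ℤ + + 2 * r) (*-≢0 (+ 2) E (λ ()) E≢0) (1+2k≢0 r) (begin
      + 2 * E * (1ℤ + + 2 * r)
        ≡⟨ expand E k l p′ ⟩
      (1ℤ + + 4 * E * k) + + 2 * (1ℤ + p′ * + 2) * (E * (1ℤ + + 2 * l)) - 1ℤ
        ≡⟨ cong (λ z → (1ℤ + + 4 * E * k) + + 2 * (1ℤ + z) * (E * (1ℤ + + 2 * l)) - 1ℤ) p≡ ⟨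
      (1ℤ + + 4 * E * k) + + 2 * (1ℤ + (p - 1ℤ)) * (E * (1ℤ + + 2 * l)) - 1ℤ
        ≡⟨ cong₂ (λ c s → c + + 2 * (1ℤ + (p - 1ℤ)) * s - 1ℤ) c≡ s≡ ⟨
      c + + 2 * (1ℤ + (p - 1ℤ)) * s - 1ℤ
        ≡⟨ collect c s p ⟩
      c + + 2 * p * s - 1ℤ
        ≡⟨ cong (_- 1ℤ) eq₁ ⟩
      0ℤ ∎)
    where
    open ≡-Reasoning
    r = k + l + p′ * (1ℤ + + 2 * l)
    expand : ∀ E k l p′ → + 2 * E * (1ℤ + + 2 * (k + l + p′ * (1ℤ + + 2 * l)))
         ≡ (1ℤ + + 4 * E * k) + + 2 * (1ℤ + p′ * + 2) * (E * (1ℤ + + 2 * l)) - 1ℤ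
    expand = solve-∀
    collect : ∀ c s p → c + + 2 * (1ℤ + (p - 1ℤ)) * s - 1ℤ ≡ c + + 2 * p * s - 1ℤ
    collect = solve-∀

  L≢1 : + 2 ∣ p - 1ℤ → + 4 ∣ p - q - 1ℤ → + 8 ∣ D → ∀ m → 0 ℕ.< m → L m ≢ 1ℤ
  L≢1 2∣ 4∣ 8∣D m 0<m L≡1 =
    close⇒≢1 (C m) (S m) 2∣ (close 4∣ 8∣D m 0<m) (trans (sym (L-def m)) L≡1)

-- Injectivity of `L` as a function of `p`.

module _ (q p₂ δ : ℤ) where
  private
    p₁ = p₂ + δ
    module L₁ = Lehmer p₁ q
    module L₂ = Lehmer p₂ q

  -- Relates (C m , S m) for p₁ and for p₂. The difference quotient in p of C is x + 2 x′, where x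
  -- will be m.
  data Difference (x : ℤ) : ℤ × ℤ → ℤ × ℤ → Set where
    difference : ∀ c s f x′ → Difference x (c + δ * (x + + 2 * x′) , s + δ * f) (c , s)

  -- With `C₁ = proj₁ w₁`, the new quotient of `C` is `C₁ + (p₂ - q)(x + 2x′)` minus a multiple of
  -- 4. As `C₁` and `p₂ - q` are odd, its parity is that of `1 + x`.
  difference-step : ∀ x w₁ w₂ → + 2 ∣ p₂ - q - 1ℤ → + 2 ∣ proj₁ w₁ - 1ℤ →
    Difference x w₁ w₂ → Difference (1ℤ + x) (L₁.β L₁.⊗ w₁) (L₂.β L₂.⊗ w₂)
  difference-step x _ _ (divides a a≡) (divides b b≡) (difference c s f x′) =
    subst₂ (λ u v → Difference (1ℤ + x) (u , v) (c′ , s′)) (re p₂ q δ c s f x x′) (im p₂ q δ c s f x x′)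
      (subst (λ z → Difference (1ℤ + x) (c′ + δ * z , s′ + δ * f′) (c′ , s′)) eq (difference c′ s′ f′ y))
    where
    c′ = (p₂ - q) * c + L₂.D * (1ℤ * s)
    s′ = (p₂ - q) * s + 1ℤ * c
    f′ = (x + + 2 * x′) + (s + δ * f) + (p₂ - q) * f
    y = b + a * x + (p₂ - q) * x′ - + 2 * q * (s + δ * f + p₂ * f)
    eq : 1ℤ + x + + 2 * y
         ≡ c + δ * (x + + 2 * x′) + (p₂ - q) * (x + + 2 * x′) - + 4 * q * (s + δ * f + p₂ * f)
    eq = begin
      1ℤ + x + + 2 * y
        ≡⟨ expand a b x x′ p₂ q s δ f ⟩
      1ℤ + x + b * + 2 + a * + 2 * x + + 2 * (p₂ - q) * x′ - + 4 * q * (s + δ * f + p₂ * f)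
        ≡⟨ cong₂ (λ a b → 1ℤ + x + b + a * x + + 2 * (p₂ - q) * x′ - + 4 * q * (s + δ * f + p₂ * f))
             a≡ b≡ ⟨
      1ℤ + x + (c + δ * (x + + 2 * x′) - 1ℤ) + (p₂ - q - 1ℤ) * x
          + + 2 * (p₂ - q) * x′ - + 4 * q * (s + δ * f + p₂ * f)
        ≡⟨ collect c x x′ p₂ q s δ f ⟩
      c + δ * (x + + 2 * x′) + (p₂ - q) * (x + + 2 * x′) - + 4 * q * (s + δ * f + p₂ * f) ∎
      where
      open ≡-Reasoning
      expand : ∀ a b x x′ p₂ q s δ f →
        1ℤ + x + + 2 * (b + a * x + (p₂ - q) * x′ - + 2 * q * (s + δ * f + p₂ * f))
        ≡ 1ℤ + x + b * + 2 + a * + 2 * x + + 2 * (p₂ - q) * x′ - + 4 * q * (s + δ * f + p₂ * f)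
      expand = solve-∀
      collect : ∀ c x x′ p₂ q s δ f →
        1ℤ + x + (c + δ * (x + + 2 * x′) - 1ℤ) + (p₂ - q - 1ℤ) * x
          + + 2 * (p₂ - q) * x′ - + 4 * q * (s + δ * f + p₂ * f)
        ≡ c + δ * (x + + 2 * x′) + (p₂ - q) * (x + + 2 * x′) - + 4 * q * (s + δ * f + p₂ * f)
      collect = solve-∀
    re : ∀ p q δ c s f x x′ →
      (p - q) * c + - (+ 4 * p * q) * (1ℤ * s)
        + δ * (c + δ * (x + + 2 * x′) + (p - q) * (x + + 2 * x′) - + 4 * q * (s + δ * f + p * f))
      ≡ (p + δ - q) * (c + δ * (x + + 2 * x′)) + - (+ 4 * (p + δ) * q) * (1ℤ * (s + δ * f))
    re = solve-∀
    im : ∀ p q δ c s f x x′ →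
      (p - q) * s + 1ℤ * c + δ * ((x + + 2 * x′) + (s + δ * f) + (p - q) * f)
      ≡ (p + δ - q) * (s + δ * f) + 1ℤ * (c + δ * (x + + 2 * x′))
    im = solve-∀

  difference-power : + 2 ∣ p₁ - q - 1ℤ → + 2 ∣ p₂ - q - 1ℤ → + 2 ∣ L₁.D →
                     ∀ m → Difference (+ m) (L₁.β L₁.^^ m) (L₂.β L₂.^^ m)
  difference-power 2∣c₁ 2∣c₂ 2∣D zero =
    subst₂ (λ u v → Difference 0ℤ (u , v) (1ℤ , 0ℤ)) (re δ) (im δ) (difference 1ℤ 0ℤ 0ℤ 0ℤ)
    where
    re : ∀ δ → 1ℤ + δ * (0ℤ + + 2 * 0ℤ) ≡ 1ℤ
    re = solve-∀
    im : ∀ δ → 0ℤ + δ * 0ℤ ≡ 0ℤ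
    im = solve-∀
  difference-power 2∣c₁ 2∣c₂ 2∣D (suc m) =
    difference-step (+ m) (L₁.β L₁.^^ m) (L₂.β L₂.^^ m) 2∣c₂ (L₁.C≡1 2∣c₁ 2∣D m)
      (difference-power 2∣c₁ 2∣c₂ 2∣D m)

  -- Here E is the largest power of 2 dividing m: it divides S and the difference quotient of S,
  -- while the quotient of C is E times an odd number.
  data Separated : ℤ × ℤ → ℤ × ℤ → Set where
    separated : ∀ E o f b g → E ≢ 0ℤ →
      Separated (1ℤ + + 2 * g + δ * (E * (1ℤ + + 2 * o)) , E * b + δ * (E * f))
                (1ℤ + + 2 * g , E * b)

  -- The quotient of `C²` is `E(1 + 2o)(C₁ + C₂)`, where `C₁ + C₂` is twice an odd number because
  -- `C₂` is odd and `4 ∣ δ`. The quotient of `D S²` is a multiple of `4E²`, so the total is `2E`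
  -- times an odd number.
  separated-square : ∀ w₁ w₂ → + 4 ∣ δ → Separated w₁ w₂ → Separated (w₁ L₁.⊗ w₁) (w₂ L₂.⊗ w₂)
  separated-square _ _ (divides d δ≡) (separated E o f b g E≢0) =
    subst₂ Separated
      (cong₂ _,_
        (trans (cong (λ z → 1ℤ + + 2 * g′ + δ * z) halve) (re₁ p₂ q δ E o f b g))
        (im₁ δ E o f b g))
      (cong₂ _,_ (re₂ p₂ q E b g) (im₂ E b g))
      (separated (+ 2 * E) o′ f′ ((1ℤ + + 2 * g) * b) g′ (*-≢0 (+ 2) E (λ ()) E≢0))
    where
    a = b + δ * f
    g′ = + 2 * g + + 2 * g * g - + 2 * p₂ * q * (E * b) * (E * b)
    o′ = g + o + + 2 * o * g + d * (E * (1ℤ + + 2 * o) * (1ℤ + + 2 * o))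
         - q * E * (a * a + p₂ * f * (a + b))
    f′ = (1ℤ + + 2 * o) * (E * a) + (1ℤ + + 2 * g) * f
    halve : + 2 * E * (1ℤ + + 2 * o′)
      ≡ E * (1ℤ + + 2 * o) * (+ 2 * (1ℤ + + 2 * g) + δ * (E * (1ℤ + + 2 * o)))
        - + 4 * q * E * E * (a * a + p₂ * f * (a + b))
    halve = trans (eq d q E o g (a * a + p₂ * f * (a + b)))
      (cong (λ z → E * (1ℤ + + 2 * o) * (+ 2 * (1ℤ + + 2 * g) + z * (E * (1ℤ + + 2 * o)))
                   - + 4 * q * E * E * (a * a + p₂ * f * (a + b))) (sym δ≡))
      where
      eq : ∀ d q E o g h →
        + 2 * E * (1ℤ + + 2 * (g + o + + 2 * o * g + d * (E * (1ℤ + + 2 * o) * (1ℤ + + 2 * o))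
                               - q * E * h))
        ≡ E * (1ℤ + + 2 * o) * (+ 2 * (1ℤ + + 2 * g) + d * + 4 * (E * (1ℤ + + 2 * o)))
          - + 4 * q * E * E * h
      eq = solve-∀
    re₁ : ∀ p q δ E o f b g →
      1ℤ + + 2 * (+ 2 * g + + 2 * g * g - + 2 * p * q * (E * b) * (E * b))
        + δ * (E * (1ℤ + + 2 * o) * (+ 2 * (1ℤ + + 2 * g) + δ * (E * (1ℤ + + 2 * o)))
        - + 4 * q * E * E * ((b + δ * f) * (b + δ * f) + p * f * (b + δ * f + b)))
      ≡ (1ℤ + + 2 * g + δ * (E * (1ℤ + + 2 * o))) * (1ℤ + + 2 * g + δ * (E * (1ℤ + + 2 * o)))
        + - (+ 4 * (p + δ) * q) * ((E * b + δ * (E * f)) * (E * b + δ * (E * f)))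
    re₁ = solve-∀
    im₁ : ∀ δ E o f b g →
      + 2 * E * ((1ℤ + + 2 * g) * b)
        + δ * (+ 2 * E * ((1ℤ + + 2 * o) * (E * (b + δ * f)) + (1ℤ + + 2 * g) * f))
      ≡ (1ℤ + + 2 * g + δ * (E * (1ℤ + + 2 * o))) * (E * b + δ * (E * f))
        + (E * b + δ * (E * f)) * (1ℤ + + 2 * g + δ * (E * (1ℤ + + 2 * o)))
    im₁ = solve-∀
    re₂ : ∀ p q E b g →
      1ℤ + + 2 * (+ 2 * g + + 2 * g * g - + 2 * p * q * (E * b) * (E * b))
      ≡ (1ℤ + + 2 * g) * (1ℤ + + 2 * g) + - (+ 4 * p * q) * (E * b * (E * b))
    re₂ = solve-∀
    im₂ : ∀ E b g → + 2 * E * ((1ℤ + + 2 * g) * b)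
                    ≡ (1ℤ + + 2 * g) * (E * b) + E * b * (1ℤ + + 2 * g)
    im₂ = solve-∀

  difference⇒separated : ∀ k w₁ w₂ → + 2 ∣ proj₁ w₂ - 1ℤ →
                         Difference (1ℤ + k * + 2) w₁ w₂ → Separated w₁ w₂
  difference⇒separated k _ _ (divides g g≡) (difference c s f x′) =
    subst₂ Separated
      (cong₂ _,_
        (trans (cong (λ z → 1ℤ + z + δ * (1ℤ * (1ℤ + + 2 * (k + x′)))) 2g≡) (re₁ c δ k x′))
        (im₁ s δ f))
      (cong₂ _,_ (trans (cong (λ z → 1ℤ + z) 2g≡) (re₂ c)) (ℤ.*-identityˡ s))
      (separated 1ℤ (k + x′) f s g (λ ()))
    where
    2g≡ : + 2 * g ≡ c - 1ℤ
    2g≡ = trans (ℤ.*-comm (+ 2) g) (sym g≡)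
    re₁ : ∀ c δ k x′ → 1ℤ + (c - 1ℤ) + δ * (1ℤ * (1ℤ + + 2 * (k + x′)))
                       ≡ c + δ * (1ℤ + k * + 2 + + 2 * x′)
    re₁ = solve-∀
    im₁ : ∀ s δ f → 1ℤ * s + δ * (1ℤ * f) ≡ s + δ * f
    im₁ = solve-∀
    re₂ : ∀ c → 1ℤ + (c - 1ℤ) ≡ c
    re₂ = solve-∀

  separated-power : + 4 ∣ δ → + 2 ∣ p₁ - q - 1ℤ → + 2 ∣ p₂ - q - 1ℤ →
                    ∀ m → 0 ℕ.< m → Separated (L₁.β L₁.^^ m) (L₂.β L₂.^^ m)
  separated-power 4∣δ 2∣c₁ 2∣c₂ = odd-double-rec _ odd
    (λ k h → subst₂ Separated (sym (L₁.β^-double k)) (sym (L₂.β^-double k))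
      (separated-square (L₁.β L₁.^^ k) (L₂.β L₂.^^ k) 4∣δ h))
    where
    2∣D : ∀ p → + 2 ∣ - (+ 4 * p * q)
    2∣D p = divides (- (+ 2 * p * q)) (eq p q)
      where
      eq : ∀ p q → - (+ 4 * p * q) ≡ - (+ 2 * p * q) * + 2
      eq = solve-∀
    odd : ∀ k → Separated (L₁.β L₁.^^ suc (k ℕ.* 2)) (L₂.β L₂.^^ suc (k ℕ.* 2))
    odd k = difference⇒separated (+ k) (L₁.β L₁.^^ suc (k ℕ.* 2)) (L₂.β L₂.^^ suc (k ℕ.* 2))
      (L₂.C≡1 2∣c₂ (2∣D p₂) (suc (k ℕ.* 2)))
      (subst (λ z → Difference z (L₁.β L₁.^^ suc (k ℕ.* 2)) (L₂.β L₂.^^ suc (k ℕ.* 2)))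
        (cong (λ z → 1ℤ + z) (ℤ.pos-* k 2))
        (difference-power 2∣c₁ 2∣c₂ (2∣D p₁) (suc (k ℕ.* 2))))

  -- The difference of the two sides is `δ E (1 + 2r)`: `C` contributes an odd multiple of `δ E`,
  -- and `2pS` an even one.
  separated⇒δ≡0 : ∀ w₁ w₂ → Separated w₁ w₂ →
    proj₁ w₁ + + 2 * p₁ * proj₂ w₁ ≡ proj₁ w₂ + + 2 * p₂ * proj₂ w₂ → δ ≡ 0ℤ
  separated⇒δ≡0 _ _ (separated E o f b g E≢0) eq =
    [ id , (λ h → contradiction h (*-≢0 E (1ℤ + + 2 * r) E≢0 (1+2k≢0 r))) ]′
      (ℤ.i*j≡0⇒i≡0∨j≡0 δ (trans (expand p₂ δ E o f b g) (ℤ.i≡j⇒i-j≡0 eq)))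
    where
    r = o + b + δ * f + p₂ * f
    expand : ∀ p δ E o f b g →
      δ * (E * (1ℤ + + 2 * (o + b + δ * f + p * f)))
      ≡ 1ℤ + + 2 * g + δ * (E * (1ℤ + + 2 * o)) + + 2 * (p + δ) * (E * b + δ * (E * f))
        - (1ℤ + + 2 * g + + 2 * p * (E * b))
    expand = solve-∀

  L-injective : + 4 ∣ δ → + 2 ∣ p₁ - q - 1ℤ → + 2 ∣ p₂ - q - 1ℤ →
                ∀ m → 0 ℕ.< m → L₁.L m ≡ L₂.L m → δ ≡ 0ℤ
  L-injective 4∣δ 2∣c₁ 2∣c₂ m 0<m L≡ =
    separated⇒δ≡0 (L₁.β L₁.^^ m) (L₂.β L₂.^^ m) (separated-power 4∣δ 2∣c₁ 2∣c₂ m 0<m)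
      (trans (sym (L₁.L-def m)) (trans L≡ (L₂.L-def m)))

-- Invertibility modulo `y`.

Unit : ℤ → ℤ → Set
Unit y z = ∃ λ s → y ∣ z * s - 1ℤ

unit-* : ∀ {y} z w → Unit y z → Unit y w → Unit y (z * w)
unit-* z w (s , y∣₁) (t , y∣₂) = s * t , ∣-lin₂ (w * t) 1ℤ y∣₁ y∣₂ (eq z w s t)
  where
  eq : ∀ z w s t → z * w * (s * t) - 1ℤ ≡ w * t * (z * s - 1ℤ) + 1ℤ * (w * t - 1ℤ)
  eq = solve-∀

unit-inverse : ∀ {y} z ((s , _) : Unit y z) → Unit y s
unit-inverse z (s , y∣) = z , subst (λ w → _ ∣ w - 1ℤ) (ℤ.*-comm z s) y∣

unit-1 : ∀ {y} → Unit y 1ℤ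
unit-1 = 1ℤ , divides 0ℤ refl

unit-^ : ∀ {y} z k → Unit y z → Unit y (z ^ℤ k)
unit-^ z zero    _ = unit-1
unit-^ z (suc k) h = unit-* z (z ^ℤ k) h (unit-^ z k h)

unit-≡ : ∀ {y} z w → y ∣ z - w → Unit y w → Unit y z
unit-≡ z w y∣ (s , y∣′) = s , ∣-lin₂ s 1ℤ y∣ y∣′ (eq z w s)
  where
  eq : ∀ z w s → z * s - 1ℤ ≡ s * (z - w) + 1ℤ * (w * s - 1ℤ)
  eq = solve-∀

unit-factor : ∀ {y} z w → Unit y (z * w) → Unit y z
unit-factor z w (s , y∣) = w * s , subst (λ a → _ ∣ a - 1ℤ) (ℤ.*-assoc z w s) y∣

-- `(1 - zs)(1 - zt)` is a multiple of `y y′` and equals `1 - z(s + t - zst)`.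
unit-modulus-* : ∀ {y y′} z → Unit y z → Unit y′ z → Unit (y * y′) z
unit-modulus-* {y} {y′} z (s , divides a a≡) (t , divides b b≡) = s + t - z * s * t ,
  divides (- (a * b)) (trans (eq z s t) (trans (cong₂ (λ a b → - (a * b)) a≡ b≡) (eq′ a b y y′)))
  where
  eq : ∀ z s t → z * (s + t - z * s * t) - 1ℤ ≡ - ((z * s - 1ℤ) * (z * t - 1ℤ))
  eq = solve-∀
  eq′ : ∀ a b y y′ → - (a * y * (b * y′)) ≡ - (a * b) * (y * y′)
  eq′ = solve-∀

unit-modulus-^ : ∀ {y} z k → Unit y z → Unit (y ^ℤ k) z
-- Modulo 1 every number is an inverse of `z`; 0 is chosen.
unit-modulus-^ z zero    _ = 0ℤ , divides (z * 0ℤ - 1ℤ) (sym (ℤ.*-identityʳ (z * 0ℤ - 1ℤ)))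
unit-modulus-^ z (suc k) h = unit-modulus-* z h (unit-modulus-^ z k h)

unit-cancel : ∀ {y} z w → Unit y z → y ∣ z * w → y ∣ w
unit-cancel z w (s , y∣) y∣zw = ∣-lin₂ s (- w) y∣zw y∣ (eq z w s)
  where
  eq : ∀ z w s → w ≡ s * (z * w) + - w * (z * s - 1ℤ)
  eq = solve-∀

-- Prime divisors of integers.

prime-∣* : ∀ {p} → Prime p → ∀ a b → + p ∣ a * b → + p ∣ a ⊎ + p ∣ b
prime-∣* {p} pr a b p∣ab = ⊎-map ∣ᵤ⇒∣ ∣ᵤ⇒∣
  (euclidsLemma (abs a) (abs b) pr (subst (p ℕ.∣_) (ℤ.abs-* a b) (∣⇒∣ᵤ p∣ab)))

prime-∣² : ∀ {p} → Prime p → ∀ a → + p ∣ a * a → + p ∣ a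
prime-∣² pr a p∣a² = [ id , id ]′ (prime-∣* pr a a p∣a²)

prime-∤1 : ∀ {p} → Prime p → ¬ + p ∣ 1ℤ
prime-∤1 {p} pr p∣1 = ℕ.>⇒∤ (ℕ.nonTrivial⇒n>1 p {{prime⇒nonTrivial pr}}) (∣⇒∣ᵤ {+ p} {1ℤ} p∣1)

prime-∣^ : ∀ {p} → Prime p → ∀ a k → + p ∣ a ^ℤ k → + p ∣ a
prime-∣^ pr a zero p∣1 = contradiction p∣1 (prime-∤1 pr)
prime-∣^ pr a (suc k) p∣ = [ id , prime-∣^ pr a k ]′ (prime-∣* pr a (a ^ℤ k) p∣)

prime-∤unit : ∀ {p} → Prime p → ∀ y z → Unit y z → + p ∣ z → ¬ + p ∣ y
prime-∤unit {p} pr y z (s , y∣) p∣z p∣y =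
  prime-∤1 pr (∣-lin₂ s (- 1ℤ) p∣z (∣-trans p∣y y∣) (eq z s))
  where
  eq : ∀ z s → 1ℤ ≡ s * z + - 1ℤ * (z * s - 1ℤ)
  eq = solve-∀

prime-2 : Prime 2
prime-2 = from-yes (prime? 2)

prime-3 : Prime 3
prime-3 = from-yes (prime? 3)

gcd≡1⇒unit : ∀ x y → gcd x y ≡ 1 → Unit (+ y) (+ x)
gcd≡1⇒unit x y eq with Bézout.identity (subst (GCD x y) eq (gcd-GCD x y))
... | Bézout.+- a b e = + a , divides (+ b) (begin
    + x * + a - 1ℤ         ≡⟨ cong (_- 1ℤ) (ℤ.*-comm (+ x) (+ a)) ⟩
    + a * + x - 1ℤ         ≡⟨ cong (_- 1ℤ) (ℤ.pos-* a x) ⟨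
    + (a ℕ.* x) - 1ℤ       ≡⟨ cong (λ z → + z - 1ℤ) e ⟨
    1ℤ + + (b ℕ.* y) - 1ℤ  ≡⟨ cancel (+ (b ℕ.* y)) ⟩
    + (b ℕ.* y)            ≡⟨ ℤ.pos-* b y ⟩
    + b * + y              ∎)
  where
  open ≡-Reasoning
  cancel : ∀ z → 1ℤ + z - 1ℤ ≡ z
  cancel = solve-∀
... | Bézout.-+ a b e = - + a , divides (- + b) (begin
    + x * - + a - 1ℤ          ≡⟨ negate (+ x) (+ a) ⟩
    - (1ℤ + + a * + x)        ≡⟨ cong (λ z → - (1ℤ + z)) (ℤ.pos-* a x) ⟨
    - (1ℤ + + (a ℕ.* x))      ≡⟨ cong (λ z → - + z) e ⟩
    - + (b ℕ.* y)             ≡⟨ cong -_ (ℤ.pos-* b y) ⟩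
    - (+ b * + y)             ≡⟨ ℤ.neg-distribˡ-* (+ b) (+ y) ⟩
    - + b * + y               ∎)
  where
  open ≡-Reasoning
  negate : ∀ x a → x * - a - 1ℤ ≡ - (1ℤ + a * x)
  negate = solve-∀

3∣⊎3∣z²-1 : ∀ z → + 3 ∣ z ⊎ + 3 ∣ z * z - 1ℤ
3∣⊎3∣z²-1 z with z %ℕ 3 | n%ℕd<d z 3 | a≡a%ℕn+[a/ℕn]*n z 3
... | 0 | _ | eq = inj₁ (divides (z /ℕ 3) (trans eq (ℤ.+-identityˡ (z /ℕ 3 * + 3))))
... | 1 | _ | eq = inj₂ (divides (+ 2 * (z /ℕ 3) + + 3 * (z /ℕ 3) * (z /ℕ 3))
    (trans (cong (λ z → z * z - 1ℤ) eq) (sq (z /ℕ 3))))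
  where
  sq : ∀ a → (1ℤ + a * + 3) * (1ℤ + a * + 3) - 1ℤ ≡ (+ 2 * a + + 3 * a * a) * + 3
  sq = solve-∀
... | 2 | _ | eq = inj₂ (divides (1ℤ + + 4 * (z /ℕ 3) + + 3 * (z /ℕ 3) * (z /ℕ 3))
    (trans (cong (λ z → z * z - 1ℤ) eq) (sq (z /ℕ 3))))
  where
  sq : ∀ a → (+ 2 + a * + 3) * (+ 2 + a * + 3) - 1ℤ ≡ (1ℤ + + 4 * a + + 3 * a * a) * + 3
  sq = solve-∀
... | suc (suc (suc _)) | ℕ.s≤s (ℕ.s≤s (ℕ.s≤s ())) | _

-- Reduction of binary quadratic forms of discriminant -24.

-- 1 and 2 are the minima of the reduced forms `i² + 6j²` and `2i² + 3j²`.
RepresentsAtMost2 : ℤ → ℤ → ℤ → Set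
RepresentsAtMost2 a b c = ∃ λ i → ∃ λ j →
  let f = a * (i * i) + + 2 * b * (i * j) + c * (j * j) in f ≡ 1ℤ ⊎ f ≡ + 2

-- `r² + 6 ≤ (a - 1)² + 6 < a²` once `2a - 1 > 6`, that is `a ≥ 4`. This is why `form-reduction`
-- treats the leading coefficients 1, 2 and 3 separately.
quotient-bound : ∀ a r z → 3 ℕ.< a → r ℕ.< a → + a * z ≡ + r * + r + + 6 →
                 ∃ λ k → z ≡ + k × k ℕ.< a × 0 ℕ.< k
quotient-bound a@(suc a-1) r -[1+ n ] _ _ eq
  with () ← trans eq (cong (_+ + 6) (sym (ℤ.pos-* r r)))
quotient-bound a r (+ zero) _ _ eq = contradiction
  (ℤ.+-injective (sym (trans (sym (ℤ.*-zeroʳ (+ a))) (trans eq (cong (_+ + 6) (sym (ℤ.pos-* r r)))))))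
  (ℕ.m+1+n≢0 (r ℕ.* r))
quotient-bound a@(suc a-1) r (+ suc k) 3<a (ℕ.s≤s r≤a-1) eq =
  suc k , refl , ℕ.≰⇒> (λ a≤k → ℕ.<⇒≱ a·k<a·a (ℕ.*-monoʳ-≤ a a≤k)) , ℕ.s≤s ℕ.z≤n
  where
  open ℕ.≤-Reasoning
  eq′ : a ℕ.* suc k ≡ r ℕ.* r ℕ.+ 6
  eq′ = ℤ.+-injective (trans (ℤ.pos-* a (suc k)) (trans eq (cong (_+ + 6) (sym (ℤ.pos-* r r)))))
  a·k<a·a : a ℕ.* suc k ℕ.< a ℕ.* a
  a·k<a·a = begin-strict
    a ℕ.* suc k                          ≡⟨ eq′ ⟩
    r ℕ.* r ℕ.+ 6                        ≤⟨ ℕ.+-monoˡ-≤ 6 (ℕ.*-mono-≤ r≤a-1 r≤a-1) ⟩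
    a-1 ℕ.* a-1 ℕ.+ 6                    ≡⟨ ℕ.+-comm (a-1 ℕ.* a-1) 6 ⟩
    3 ℕ.+ 3 ℕ.+ a-1 ℕ.* a-1              <⟨ ℕ.n<1+n _ ⟩
    suc (3 ℕ.+ 3 ℕ.+ a-1 ℕ.* a-1)        ≤⟨ ℕ.s≤s (ℕ.+-monoˡ-≤ (a-1 ℕ.* a-1)
                                               (ℕ.+-mono-≤ (ℕ.≤-pred 3<a) (ℕ.≤-pred 3<a))) ⟩
    suc (a-1 ℕ.+ a-1 ℕ.+ a-1 ℕ.* a-1)    ≡⟨ cong suc (ℕ.+-assoc a-1 a-1 _) ⟩
    suc (a-1 ℕ.+ (a-1 ℕ.+ a-1 ℕ.* a-1))  ≡⟨ cong (λ z → suc (a-1 ℕ.+ z)) (ℕ.*-suc a-1 a-1) ⟨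
    a ℕ.* a                              ∎

-- a i² + 2 b i j + c j² is a positive form of discriminant -24; reduce it until a ≤ 3.
form-reduction : ∀ a → 0 ℕ.< a → ∀ b c → + a * c ≡ b * b + + 6 → RepresentsAtMost2 (+ a) b c
form-reduction = <-rec _ step
  where
  step : ∀ a → (∀ {k} → k ℕ.< a → 0 ℕ.< k →
                ∀ b c → + k * c ≡ b * b + + 6 → RepresentsAtMost2 (+ k) b c) →
         0 ℕ.< a → ∀ b c → + a * c ≡ b * b + + 6 → RepresentsAtMost2 (+ a) b c
  step 1 rec _ b c eq = 1ℤ , 0ℤ , inj₁ (at b c)
    where
    at : ∀ b c → 1ℤ * (1ℤ * 1ℤ) + + 2 * b * (1ℤ * 0ℤ) + c * (0ℤ * 0ℤ) ≡ 1ℤ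
    at = solve-∀
  step 2 rec _ b c eq = 1ℤ , 0ℤ , inj₂ (at b c)
    where
    at : ∀ b c → + 2 * (1ℤ * 1ℤ) + + 2 * b * (1ℤ * 0ℤ) + c * (0ℤ * 0ℤ) ≡ + 2
    at = solve-∀
  step 3 rec _ b c eq with prime-∣² prime-3 b
      ((∣-lin₂ 1ℤ (- + 2) {+ 3} (divides c (trans (sym eq) (ℤ.*-comm (+ 3) c))) ∣-refl (split b)))
    where
    split : ∀ b → b * b ≡ 1ℤ * (b * b + + 6) + - + 2 * + 3
    split = solve-∀
  -- For `b = 3q` the form is `3(i + qj)² + 2j²`.
  ... | divides q b≡ = - q , 1ℤ , inj₂ (ℤ.*-cancelˡ-≡ (+ 3) _ (+ 2) (begin
    + 3 * (+ 3 * (- q * - q) + + 2 * b * (- q * 1ℤ) + c * (1ℤ * 1ℤ))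
      ≡⟨ expand q b c ⟩
    q * + 3 * (q * + 3) - + 2 * b * (q * + 3) + + 3 * c
      ≡⟨ cong (λ z → q * + 3 * (q * + 3) - + 2 * b * (q * + 3) + z) eq ⟩
    q * + 3 * (q * + 3) - + 2 * b * (q * + 3) + (b * b + + 6)
      ≡⟨ cong (λ z → z * z - + 2 * b * z + (b * b + + 6)) b≡ ⟨
    b * b - + 2 * b * b + (b * b + + 6)
      ≡⟨ collect b ⟩
    + 3 * + 2 ∎))
    where
    open ≡-Reasoning
    expand : ∀ q b c → + 3 * (+ 3 * (- q * - q) + + 2 * b * (- q * 1ℤ) + c * (1ℤ * 1ℤ))
                       ≡ q * + 3 * (q * + 3) - + 2 * b * (q * + 3) + + 3 * c
    expand = solve-∀
    collect : ∀ b → b * b - + 2 * b * b + (b * b + + 6) ≡ + 3 * + 2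
    collect = solve-∀
  step a@(suc (suc (suc (suc _)))) rec _ b c eq = finish
    (quotient-bound a (b %ℕ a) c′ (ℕ.s≤s (ℕ.s≤s (ℕ.s≤s (ℕ.s≤s ℕ.z≤n)))) (n%ℕd<d b a)
      (reduced (+ a) (+ (b %ℕ a)) (b /ℕ a) b c eq (a≡a%ℕn+[a/ℕn]*n b a)))
    where
    -- With `b = r + q a`, evaluation at `(j - q i , i)` turns the form `(a , b , c)` into
    -- `(c′ , r , a)`, whose leading coefficient is smaller.
    c′ = c - + 2 * + (b %ℕ a) * (b /ℕ a) - (b /ℕ a) * (b /ℕ a) * + a
    reduced : ∀ a r q b c → a * c ≡ b * b + + 6 → b ≡ r + q * a →
              a * (c - + 2 * r * q - q * q * a) ≡ r * r + + 6
    reduced a r q b c eq refl = trans (expand a r q c)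
      (trans (cong (λ z → z - + 2 * r * q * a - q * q * a * a) eq) (collect a r q))
      where
      expand : ∀ a r q c → a * (c - + 2 * r * q - q * q * a) ≡ a * c - + 2 * r * q * a - q * q * a * a
      expand = solve-∀
      collect : ∀ a r q → (r + q * a) * (r + q * a) + + 6 - + 2 * r * q * a - q * q * a * a ≡ r * r + + 6
      collect = solve-∀
    substitute : ∀ a r q b c k i j → b ≡ r + q * a → c - + 2 * r * q - q * q * a ≡ k →
      a * ((j - q * i) * (j - q * i)) + + 2 * b * ((j - q * i) * i) + c * (i * i)
      ≡ k * (i * i) + + 2 * r * (i * j) + a * (j * j)
    substitute a r q b c k i j refl refl = expand a r q c i j
      where
      expand : ∀ a r q c i j →
        a * ((j - q * i) * (j - q * i)) + + 2 * (r + q * a) * ((j - q * i) * i) + c * (i * i)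
        ≡ (c - + 2 * r * q - q * q * a) * (i * i) + + 2 * r * (i * j) + a * (j * j)
      expand = solve-∀
    finish : (∃ λ k → c′ ≡ + k × k ℕ.< a × 0 ℕ.< k) → RepresentsAtMost2 (+ a) b c
    finish (k , c′≡ , k<a , 0<k)
      with rec k<a 0<k (+ (b %ℕ a)) (+ a)
             (trans (trans (ℤ.*-comm (+ k) (+ a)) (cong (+ a *_) (sym c′≡)))
                    (reduced (+ a) (+ (b %ℕ a)) (b /ℕ a) b c eq (a≡a%ℕn+[a/ℕn]*n b a)))
    ... | i , j , h = j - (b /ℕ a) * i , i ,
      subst (λ z → z ≡ 1ℤ ⊎ z ≡ + 2)
        (sym (substitute (+ a) (+ (b %ℕ a)) (b /ℕ a) b c (+ k) i j (a≡a%ℕn+[a/ℕn]*n b a) c′≡)) h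

square-abs : ∀ z → z * z ≡ + (abs z ℕ.* abs z)
square-abs (+ n)    = sym (ℤ.pos-* n n)
square-abs -[1+ n ] = refl

positive-cofactor : ∀ k z n → z * + suc k ≡ + suc n → ∃ λ a → z ≡ + a × 0 ℕ.< a
positive-cofactor k (+ suc a) n eq = suc a , refl , ℕ.s≤s ℕ.z≤n

P Q : ℤ → ℤ
P u = + 3 * (u * u)
Q v = + 2 * (v * v)

-- Put `a = (3t² + 2) / y`. Then `y` times `a i² + 6t i j + 3y j²` is `3(it + jy)² + 2i²`, so the
-- values 1 and 2 of this form give `y` and `2y`, with `u = it + jy` and `v = i`.
norm-form : ∀ y t → (∃ λ k → y ≡ + suc k) → y ∣ P t + + 2 → ∃ λ u → ∃ λ v →
  y ∣ u - t * v × ((P u + Q v ≡ y × Unit y v) ⊎ P u + Q v ≡ + 2 * y)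
norm-form _ t (k , refl) (divides z z≡)
  with positive-cofactor k z (suc (3 ℕ.* (abs t ℕ.* abs t))) (begin
    z * y                             ≡⟨ z≡ ⟨
    + 3 * (t * t) + + 2               ≡⟨ cong (λ s → + 3 * s + + 2) (square-abs t) ⟩
    + 3 * + (abs t ℕ.* abs t) + + 2   ≡⟨ cong (_+ + 2) (ℤ.pos-* 3 (abs t ℕ.* abs t)) ⟨
    + (3 ℕ.* (abs t ℕ.* abs t) ℕ.+ 2) ≡⟨ cong +_ (ℕ.+-comm _ 2) ⟩
    + (2 ℕ.+ 3 ℕ.* (abs t ℕ.* abs t)) ∎)
  where
  open ≡-Reasoning
  y = + suc k
... | a , refl , 0<a
  with form-reduction a 0<a (+ 3 * t) (+ 3 * + suc k) (discriminant (+ a) t (+ suc k) z≡)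
  where
  discriminant : ∀ a t y → + 3 * (t * t) + + 2 ≡ a * y → a * (+ 3 * y) ≡ + 3 * t * (+ 3 * t) + + 6
  discriminant a t y eq = trans (swap a y) (trans (cong (+ 3 *_) (sym eq)) (expand t))
    where
    swap : ∀ a y → a * (+ 3 * y) ≡ + 3 * (a * y)
    swap = solve-∀
    expand : ∀ t → + 3 * (+ 3 * (t * t) + + 2) ≡ + 3 * t * (+ 3 * t) + + 6
    expand = solve-∀
... | i , j , h = i * t + j * y , i , divides j (congruent i j t y) , ⊎-map
    (λ f≡1 → trans (value (+ a) i j t y z≡) (trans (cong (y *_) f≡1) (ℤ.*-identityʳ y)) ,
             (+ a * i + + 6 * t * j , divides (- (+ 3 * (j * j))) (unit (+ a) i j t y f≡1)))
    (λ f≡2 → trans (value (+ a) i j t y z≡) (trans (cong (y *_) f≡2) (ℤ.*-comm y (+ 2)))) h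
  where
  y = + suc k
  congruent : ∀ i j t y → i * t + j * y - t * i ≡ j * y
  congruent = solve-∀
  value : ∀ a i j t y → + 3 * (t * t) + + 2 ≡ a * y →
    + 3 * ((i * t + j * y) * (i * t + j * y)) + + 2 * (i * i)
    ≡ y * (a * (i * i) + + 2 * (+ 3 * t) * (i * j) + + 3 * y * (j * j))
  value a i j t y eq = trans (expand i j t y)
    (trans (cong (λ z → z * (i * i) + y * (+ 2 * (+ 3 * t) * (i * j) + + 3 * y * (j * j))) eq)
      (collect a i j t y))
    where
    expand : ∀ i j t y → + 3 * ((i * t + j * y) * (i * t + j * y)) + + 2 * (i * i)
      ≡ (+ 3 * (t * t) + + 2) * (i * i) + y * (+ 2 * (+ 3 * t) * (i * j) + + 3 * y * (j * j))
    expand = solve-∀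
    collect : ∀ a i j t y → a * y * (i * i) + y * (+ 2 * (+ 3 * t) * (i * j) + + 3 * y * (j * j))
      ≡ y * (a * (i * i) + + 2 * (+ 3 * t) * (i * j) + + 3 * y * (j * j))
    collect = solve-∀
  unit : ∀ a i j t y → a * (i * i) + + 2 * (+ 3 * t) * (i * j) + + 3 * y * (j * j) ≡ 1ℤ →
         i * (a * i + + 6 * t * j) - 1ℤ ≡ - (+ 3 * (j * j)) * y
  unit a i j t y eq = trans (cong (λ z → i * (a * i + + 6 * t * j) - z) (sym eq)) (expand a i j t y)
    where
    expand : ∀ a i j t y → i * (a * i + + 6 * t * j)
        - (a * (i * i) + + 2 * (+ 3 * t) * (i * j) + + 3 * y * (j * j)) ≡ - (+ 3 * (j * j)) * y
    expand = solve-∀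

-- Pairs with the same value of `3x² + 2d²`.

small-multiple : ∀ a k N → N ≢ 0ℤ → a * a + + 6 * (k * N) * (k * N) ≡ N * N → k ≡ 0ℤ
small-multiple a k N N≢0 eq = go (abs k) refl
  where
  N² = abs N ℕ.* abs N
  N²≢0 : ℕ.NonZero N²
  N²≢0 = ℕ.m*n≢0 (abs N) (abs N) {{≢-nonZero N≢0}} {{≢-nonZero N≢0}}
  go : ∀ j → abs k ≡ j → k ≡ 0ℤ
  go zero    k≡ = ℤ.∣i∣≡0⇒i≡0 k≡
  go (suc j) k≡ = contradiction (ℕ.≤-reflexive inℕ) (ℕ.<⇒≱ N²<)
    where
    k² = suc j ℕ.* suc j
    inℕ : abs a ℕ.* abs a ℕ.+ 6 ℕ.* (k² ℕ.* N²) ≡ N²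
    inℕ = ℤ.+-injective (begin
      + (abs a ℕ.* abs a) + + (6 ℕ.* (k² ℕ.* N²))
        ≡⟨ cong₂ _+_ (sym (square-abs a))
             (trans (ℤ.pos-* 6 (k² ℕ.* N²)) (cong (+ 6 *_) (ℤ.pos-* k² N²))) ⟩
      a * a + + 6 * (+ k² * + N²)
        ≡⟨ cong₂ (λ u v → a * a + + 6 * (u * v))
             (trans (square-abs k) (cong (λ z → + (z ℕ.* z)) k≡)) (square-abs N) ⟨
      a * a + + 6 * (k * k * (N * N))
        ≡⟨ collect a k N ⟩
      a * a + + 6 * (k * N) * (k * N)
        ≡⟨ eq ⟩
      N * N
        ≡⟨ square-abs N ⟩
      + N² ∎)
      where
      open ≡-Reasoning
      collect : ∀ a k N → a * a + + 6 * (k * k * (N * N)) ≡ a * a + + 6 * (k * N) * (k * N)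
      collect = solve-∀
    N²< : N² ℕ.< abs a ℕ.* abs a ℕ.+ 6 ℕ.* (k² ℕ.* N²)
    N²< = ℕ.<-≤-trans
      (ℕ.≤-<-trans (ℕ.m≤n*m N² k²)
        (subst (k² ℕ.* N² ℕ.<_) (ℕ.*-comm (k² ℕ.* N²) 6)
          (ℕ.m<m*n (k² ℕ.* N²) 6 {{ℕ.m*n≢0 k² N² {{_}} {{N²≢0}}}} (ℕ.s≤s (ℕ.s≤s ℕ.z≤n)))))
      (ℕ.m≤n+m (6 ℕ.* (k² ℕ.* N²)) (abs a ℕ.* abs a))

square-injective : ∀ a b → a * a ≡ b * b → a ≡ b ⊎ a ≡ - b
square-injective a b eq = ⊎-map (ℤ.i-j≡0⇒i≡j a b)
  (λ h → trans (shift a b) (trans (cong (_+ - b) h) (ℤ.+-identityˡ (- b))))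
  (ℤ.i*j≡0⇒i≡0∨j≡0 (a - b) (trans (expand a b) (ℤ.i≡j⇒i-j≡0 eq)))
  where
  expand : ∀ a b → (a - b) * (a + b) ≡ a * a - b * b
  expand = solve-∀
  shift : ∀ a b → a ≡ (a + b) + - b
  shift = solve-∀

^-≡1 : ∀ {k} z n → k ∣ z - 1ℤ → k ∣ z ^ℤ n - 1ℤ
^-≡1 z zero    h = divides 0ℤ refl
^-≡1 z (suc n) h = ∣-lin₂ z 1ℤ (^-≡1 z n h) h (eq z (z ^ℤ n))
  where
  eq : ∀ z w → z * w - 1ℤ ≡ z * (w - 1ℤ) + 1ℤ * (z - 1ℤ)
  eq = solve-∀

^-≢0 : ∀ z n → z ≢ 0ℤ → z ^ℤ n ≢ 0ℤ
^-≢0 z zero    z≢0 = λ ()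
^-≢0 z (suc n) z≢0 = *-≢0 z (z ^ℤ n) z≢0 (^-≢0 z n z≢0)

N₃₂ : ℤ → ℤ → ℤ
N₃₂ x d = + 3 * (x * x) + + 2 * (d * d)

-- x / d and X / Y are roots of 3t² + 2 modulo y ^ k that agree modulo y, so they are equal.
same-root : ∀ y k t x d X Y → N₃₂ x d ≡ y ^ℤ k → N₃₂ X Y ≡ y ^ℤ k →
  y ∣ x - t * d → y ∣ X - t * Y →
  Unit y (+ 2) → Unit y (+ 3) → Unit y t → Unit y d → Unit y Y → y ^ℤ k ∣ x * Y - X * d
same-root y k t x d X Y N≡ N≡′ x≡ X≡ u₂ u₃ uₜ u_d u_Y =
  unit-cancel (+ 3 * (x * Y + X * d)) (x * Y - X * d)
    (unit-modulus-^ (+ 3 * (x * Y + X * d)) k (unit-* (+ 3) (x * Y + X * d) u₃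
      (unit-≡ (x * Y + X * d) (+ 2 * (t * (d * Y))) (∣-lin₂ Y d x≡ X≡ (sum x X t d Y))
        (unit-* (+ 2) (t * (d * Y)) u₂ (unit-* t (d * Y) uₜ (unit-* d Y u_d u_Y))))))
    (divides (Y * Y - d * d) (trans (expand x X d Y)
      (trans (cong₂ (λ a b → Y * Y * a - d * d * b) N≡ N≡′) (collect Y d (y ^ℤ k)))))
  where
  sum : ∀ x X t d Y → x * Y + X * d - + 2 * (t * (d * Y)) ≡ Y * (x - t * d) + d * (X - t * Y)
  sum = solve-∀
  expand : ∀ x X d Y → + 3 * (x * Y + X * d) * (x * Y - X * d)
    ≡ Y * Y * (+ 3 * (x * x) + + 2 * (d * d)) - d * d * (+ 3 * (X * X) + + 2 * (Y * Y))
  expand = solve-∀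
  collect : ∀ Y d N → Y * Y * N - d * d * N ≡ (Y * Y - d * d) * N
  collect = solve-∀

-- Once `small-multiple` has removed `xY - Xd`, Brahmagupta's identity reads `A² = N²`, and
-- `N Y = A d` turns the sign of `A` into the sign between `d` and `Y`.
equal-up-to-sign : ∀ N x d X Y → N ≢ 0ℤ → N₃₂ x d ≡ N → N₃₂ X Y ≡ N →
                   N ∣ x * Y - X * d → d ≡ Y ⊎ d ≡ - Y
equal-up-to-sign N x d X Y N≢0 N≡ N≡′ (divides k cross) = ⊎-map
    (λ A≡N → ℤ.*-cancelˡ-≡ N d Y {{≢-nonZero N≢0}} (trans (cong (_* d) (sym A≡N)) (sym dA)))
    (λ A≡-N → ℤ.*-cancelˡ-≡ N d (- Y) {{≢-nonZero N≢0}}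
       (trans (neg N d) (trans (cong -_ (trans (cong (_* d) (sym A≡-N)) (sym dA)))
         (ℤ.neg-distribʳ-* N Y))))
    (square-injective A N (trans (sym (ℤ.+-identityʳ (A * A)))
       (trans (cong (λ z → A * A + + 6 * (z * N) * (z * N)) (sym k≡0)) A²)))
  where
  A = + 3 * (x * X) + + 2 * (d * Y)
  A² : A * A + + 6 * (k * N) * (k * N) ≡ N * N
  A² = trans (cong (λ z → A * A + + 6 * z * z) (sym cross))
    (trans (brahmagupta x d X Y) (cong₂ _*_ N≡ N≡′))
    where
    brahmagupta : ∀ x d X Y →
      (+ 3 * (x * X) + + 2 * (d * Y)) * (+ 3 * (x * X) + + 2 * (d * Y))
        + + 6 * (x * Y - X * d) * (x * Y - X * d)
      ≡ (+ 3 * (x * x) + + 2 * (d * d)) * (+ 3 * (X * X) + + 2 * (Y * Y))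
    brahmagupta = solve-∀
  k≡0 : k ≡ 0ℤ
  k≡0 = small-multiple A k N N≢0 A²
  dA : N * Y ≡ A * d
  dA = trans (cong (_* Y) (sym N≡)) (trans (expand x d X Y)
    (trans (cong (λ z → + 3 * (x * z) + + 2 * (d * (d * Y))) (ℤ.i-j≡0⇒i≡j (x * Y) (X * d)
      (trans cross (trans (cong (_* N) k≡0) (ℤ.*-zeroˡ N))))) (collect x d X Y)))
    where
    expand : ∀ x d X Y → (+ 3 * (x * x) + + 2 * (d * d)) * Y ≡ + 3 * (x * (x * Y)) + + 2 * (d * (d * Y))
    expand = solve-∀
    collect : ∀ x d X Y → + 3 * (x * (X * d)) + + 2 * (d * (d * Y)) ≡ (+ 3 * (x * X) + + 2 * (d * Y)) * d
    collect = solve-∀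
  neg : ∀ N d → N * d ≡ - (- N * d)
  neg = solve-∀

-- The representation `d = v L`.

record Representation (m : ℕ) (d y : ℤ) : Set where
  field
    u v : ℤ
    y≡  : y ≡ P u + Q v
    d≡  : d ≡ v * Lehmer.L (P u) (Q v) m

module _ (m : ℕ) (x d y : ℤ) (0<y : ∃ λ k → y ≡ + suc k) (3∤y : ¬ + 3 ∣ y) (3∤d : ¬ + 3 ∣ d)
         (ux : Unit y x) (eq : N₃₂ x d ≡ y ^ℤ suc (m ℕ.* 2)) where
  open Lehmer using (K; L)

  unit-3 : Unit y (+ 3)
  unit-3 with 3∣⊎3∣z²-1 y
  ... | inj₁ 3∣y = contradiction 3∣y 3∤y
  -- From `y² - 1 = 3a`, `- a` inverts 3 modulo `y`.
  ... | inj₂ (divides a y²≡) = - a , divides (- y)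
    (trans (swap a) (trans (cong (λ z → - z - 1ℤ) (sym y²≡)) (collect y)))
    where
    swap : ∀ a → + 3 * - a - 1ℤ ≡ - (a * + 3) - 1ℤ
    swap = solve-∀
    collect : ∀ y → - (y * y - 1ℤ) - 1ℤ ≡ - y * y
    collect = solve-∀

  y∣N : y ∣ N₃₂ x d
  y∣N = divides (y ^ℤ (m ℕ.* 2)) (trans eq (ℤ.*-comm y (y ^ℤ (m ℕ.* 2))))

  unit-2d² : Unit y (+ 2 * (d * d))
  unit-2d² = unit-≡ (+ 2 * (d * d)) (- 1ℤ * (+ 3 * (x * x)))
    (∣-lin₁ 1ℤ y∣N (same x d))
    (unit-* (- 1ℤ) (+ 3 * (x * x)) (- 1ℤ , divides 0ℤ refl)
      (unit-* (+ 3) (x * x) unit-3 (unit-* x x ux ux)))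
    where
    same : ∀ x d → + 2 * (d * d) - - 1ℤ * (+ 3 * (x * x)) ≡ 1ℤ * (+ 3 * (x * x) + + 2 * (d * d))
    same = solve-∀

  unit-2 : Unit y (+ 2)
  unit-2 = unit-factor (+ 2) (d * d) unit-2d²

  unit-d : Unit y d
  unit-d = unit-factor d (d * + 2) (subst (Unit y) (swap d) unit-2d²)
    where
    swap : ∀ d → + 2 * (d * d) ≡ d * (d * + 2)
    swap = solve-∀

  -- Since `yⁿ ≡ 2d² ≡ 2` modulo 3, `y` cannot be 1 modulo 3. This discards `P u + Q v = 2y`, which
  -- reduces to `y ≡ v²` modulo 3.
  y≢square : ∀ v → ¬ + 3 ∣ y - v * v
  y≢square v 3∣ with 3∣⊎3∣z²-1 v | 3∣⊎3∣z²-1 d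
  ... | inj₁ 3∣v | _ = 3∤y (∣-lin₂ 1ℤ v 3∣ 3∣v (shift y v))
    where
    shift : ∀ y v → y ≡ 1ℤ * (y - v * v) + v * v
    shift = solve-∀
  ... | inj₂ _ | inj₁ 3∣d = 3∤d 3∣d
  ... | inj₂ 3∣v²-1 | inj₂ 3∣d²-1 = prime-∤1 prime-3 (∣-lin₃ 1ℤ (- + 2) (- (x * x)) 3∣N-1 3∣d²-1 ∣-refl
    (trans (one x d) (cong (λ z → 1ℤ * (z - 1ℤ) + - + 2 * (d * d - 1ℤ) + - (x * x) * + 3) eq)))
    where
    3∣N-1 : + 3 ∣ y ^ℤ suc (m ℕ.* 2) - 1ℤ
    3∣N-1 = ^-≡1 y (suc (m ℕ.* 2)) (∣-lin₂ 1ℤ 1ℤ 3∣ 3∣v²-1 (shift y v))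
      where
      shift : ∀ y v → y - 1ℤ ≡ 1ℤ * (y - v * v) + 1ℤ * (v * v - 1ℤ)
      shift = solve-∀
    one : ∀ x d → 1ℤ ≡ 1ℤ * (+ 3 * (x * x) + + 2 * (d * d) - 1ℤ) + - + 2 * (d * d - 1ℤ) + - (x * x) * + 3
    one = solve-∀

  module _ (s : ℤ) (ds≡1 : y ∣ d * s - 1ℤ) where
    t : ℤ
    t = x * s

    x≡td : y ∣ x - t * d
    x≡td = ∣-lin₁ (- x) (ds≡1) (expand x s d)
      where
      expand : ∀ x s d → x - x * s * d ≡ - x * (d * s - 1ℤ)
      expand = solve-∀

    t-root : y ∣ P t + + 2
    t-root = ∣-lin₂ (s * s) (- (+ 2 * (d * s + 1ℤ))) y∣N (ds≡1) (expand x s d)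
      where
      expand : ∀ x s d → + 3 * (x * s * (x * s)) + + 2
        ≡ s * s * (+ 3 * (x * x) + + 2 * (d * d)) + - (+ 2 * (d * s + 1ℤ)) * (d * s - 1ℤ)
      expand = solve-∀

    unit-t : Unit y t
    unit-t = unit-* x s ux (unit-inverse d (s , ds≡1))

    norm-y : ∃ λ u → ∃ λ v → y ∣ u - t * v × P u + Q v ≡ y × Unit y v
    norm-y with norm-form y t 0<y t-root
    ... | u , v , u≡ , inj₁ (norm≡ , unit-v) = u , v , u≡ , norm≡ , unit-v
    ... | u , v , u≡ , inj₂ norm≡2y = contradiction
      (unit-cancel (+ 2) (y - v * v) (- 1ℤ , divides (- 1ℤ) refl)
        (∣-lin₁ (u * u) ∣-refl (trans (expand y v)
          (trans (cong (_- + 2 * (v * v)) (sym norm≡2y)) (collect u v)))))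
      (y≢square v)
      where
      expand : ∀ y v → + 2 * (y - v * v) ≡ + 2 * y - + 2 * (v * v)
      expand = solve-∀
      collect : ∀ u v → + 3 * (u * u) + + 2 * (v * v) - + 2 * (v * v) ≡ u * u * + 3
      collect = solve-∀

    representation-with-inverse : Representation m d y
    representation-with-inverse = let u , v , u≡ , norm≡ , unit-v = norm-y in build u v u≡ norm≡ unit-v
      where
      build : ∀ u v → y ∣ u - t * v → P u + Q v ≡ y → Unit y v → Representation m d y
      build u v u≡ norm≡ unit-v = [ (λ d≡ → record { u = u ; v = v ; y≡ = sym norm≡ ; d≡ = d≡ })
        -- `L` depends on `v` only through `v²`, so `v` absorbs the sign.
        , (λ d≡ → record { u = u ; v = - v
                         ; y≡ = trans (sym norm≡) (cong (λ z → P u + + 2 * z) (square-neg v))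
                         ; d≡ = trans d≡ (trans (ℤ.neg-distribˡ-* v l)
                                  (cong (λ z → - v * L (P u) (+ 2 * z) m) (square-neg v))) }) ]′
        (equal-up-to-sign N x d X Y (^-≢0 y (suc (m ℕ.* 2)) y≢0) eq N≡
          (same-root y (suc (m ℕ.* 2)) t x d X Y eq N≡ x≡td X≡tY unit-2 unit-3 unit-t unit-d unit-Y))
        where
        l = L (P u) (Q v) m
        κ = K (P u) (Q v) m
        X = u * κ
        Y = v * l
        N = y ^ℤ suc (m ℕ.* 2)
        y≢0 : y ≢ 0ℤ
        y≢0 y≡0 with () ← trans (sym y≡0) (proj₂ 0<y)
        square-neg : ∀ v → v * v ≡ - v * - v
        square-neg = solve-∀
        N≡ : N₃₂ X Y ≡ N
        N≡ = trans (expand u v κ l) (trans (Lehmer.norm-KL (P u) (Q v) m)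
          (cong (_^ℤ suc (m ℕ.* 2)) norm≡))
          where
          expand : ∀ u v κ l → + 3 * (u * κ * (u * κ)) + + 2 * (v * l * (v * l))
                               ≡ + 3 * (u * u) * (κ * κ) + + 2 * (v * v) * (l * l)
          expand = solve-∀
        X≡tY : y ∣ X - t * Y
        X≡tY = ∣-lin₂ κ (t * v) u≡ (subst (_∣ κ - l) norm≡ (Lehmer.K≡L (P u) (Q v) m)) (expand u v κ l t)
          where
          expand : ∀ u v κ l t → u * κ - t * (v * l) ≡ κ * (u - t * v) + t * v * (κ - l)
          expand = solve-∀
        -- `l ≡ (3P - Q)ᵐ`, and `3P - Q ≡ -4Q = -8v²` modulo `y = P + Q`, which is a product of
        -- units.
        unit-Y : Unit y Y
        unit-Y = unit-* v l unit-v
          (unit-≡ l ((+ 3 * P u - Q v) ^ℤ m)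
            (subst (_∣ l - (+ 3 * P u - Q v) ^ℤ m) norm≡ (Lehmer.L-mod-p+q (P u) (Q v) m))
            (unit-^ (+ 3 * P u - Q v) m
              (unit-≡ (+ 3 * P u - Q v) (- 1ℤ * (+ 2 * (+ 2 * (+ 2 * (v * v)))))
              (∣-lin₁ (+ 3) ∣-refl (trans (collect u v) (cong (+ 3 *_) norm≡)))
              (unit-* (- 1ℤ) (+ 2 * (+ 2 * (+ 2 * (v * v)))) (- 1ℤ , divides 0ℤ refl)
                (unit-* (+ 2) (+ 2 * (+ 2 * (v * v))) unit-2
                  (unit-* (+ 2) (+ 2 * (v * v)) unit-2
                    (unit-* (+ 2) (v * v) unit-2 (unit-* v v unit-v unit-v))))))))
          where
          collect : ∀ u v →
            + 3 * (+ 3 * (u * u)) - + 2 * (v * v) - - 1ℤ * (+ 2 * (+ 2 * (+ 2 * (v * v))))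
                            ≡ + 3 * (+ 3 * (u * u) + + 2 * (v * v))
          collect = solve-∀

  representation : Representation m d y
  representation = representation-with-inverse (proj₁ unit-d) (proj₂ unit-d)

prime∣prime : ∀ {p q} → Prime p → Prime q → + p ∣ + q → p ≡ q
prime∣prime {p} {q} pr qr p∣q with prime⇒irreducible qr (∣⇒∣ᵤ {+ p} {+ q} p∣q)
... | inj₁ refl = contradiction (∣-refl {1ℤ}) (prime-∤1 pr)
... | inj₂ p≡q = p≡q

prime-power-coprime-factor : ∀ {p} → Prime p → ∀ r a b → a ℕ.* b ≡ p ℕ.^ r → ¬ p ℕ.∣ a → a ≡ 1
prime-power-coprime-factor pr zero a b eq p∤a = ℕ.m*n≡1⇒m≡1 a b eq
prime-power-coprime-factor {p} pr (suc r) a b eq p∤a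
  with euclidsLemma a b pr (subst (p ℕ.∣_) (sym eq) (ℕ.m∣m*n (p ℕ.^ r)))
... | inj₁ p∣a = contradiction p∣a p∤a
... | inj₂ (ℕ.divides b′ refl) = prime-power-coprime-factor pr r a b′
  (ℕ.*-cancelʳ-≡ (a ℕ.* b′) (p ℕ.^ r) p {{prime⇒nonZero pr}}
    (trans (ℕ.*-assoc a b′ p) (trans eq (ℕ.*-comm p (p ℕ.^ r))))) p∤a

2∣⊎8∣z²-1 : ∀ z → + 2 ∣ z ⊎ + 8 ∣ z * z - 1ℤ
2∣⊎8∣z²-1 z with z %ℕ 4 | n%ℕd<d z 4 | a≡a%ℕn+[a/ℕn]*n z 4
... | 0 | _ | eq = inj₁ (divides (+ 2 * (z /ℕ 4)) (trans eq (even (z /ℕ 4))))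
  where
  even : ∀ a → 0ℤ + a * + 4 ≡ + 2 * a * + 2
  even = solve-∀
... | 2 | _ | eq = inj₁ (divides (1ℤ + + 2 * (z /ℕ 4)) (trans eq (even (z /ℕ 4))))
  where
  even : ∀ a → + 2 + a * + 4 ≡ (1ℤ + + 2 * a) * + 2
  even = solve-∀
... | 1 | _ | eq = inj₂ (divides ((z /ℕ 4) + + 2 * (z /ℕ 4) * (z /ℕ 4))
    (trans (cong (λ z → z * z - 1ℤ) eq) (sq (z /ℕ 4))))
  where
  sq : ∀ a → (1ℤ + a * + 4) * (1ℤ + a * + 4) - 1ℤ ≡ (a + + 2 * a * a) * + 8
  sq = solve-∀
... | 3 | _ | eq = inj₂ (divides (1ℤ + + 3 * (z /ℕ 4) + + 2 * (z /ℕ 4) * (z /ℕ 4))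
    (trans (cong (λ z → z * z - 1ℤ) eq) (sq (z /ℕ 4))))
  where
  sq : ∀ a → (+ 3 + a * + 4) * (+ 3 + a * + 4) - 1ℤ ≡ (1ℤ + + 3 * a + + 2 * a * a) * + 8
  sq = solve-∀
... | suc (suc (suc (suc _))) | ℕ.s≤s (ℕ.s≤s (ℕ.s≤s (ℕ.s≤s ()))) | _

-- Arithmetic of `L` at `p = 3u²` and `q = 2v²`.

module _ (u v : ℤ) where
  private module L = Lehmer (P u) (Q v)

  module ℤ[√-6] = Quadratic (- + 6)

  -- `3u + v√-6 = √3 (u√3 + v√-2)`, so the power is `3ᵐ βᵐ` with `√D = 2uv√-6`. The factor `√3`
  -- brings the odd powers of `u√3 + v√-2` into a quadratic ring, where `im-frobenius` applies.
  [3u+v√-6]^even : ∀ m → (+ 3 * u , v) ℤ[√-6].^^ (m ℕ.* 2) ≡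
                   ((+ 3) ^ℤ m * L.C m , (+ 3) ^ℤ m * (+ 2 * (u * v) * L.S m))
  [3u+v√-6]^even zero    = cong (1ℤ ,_) (eq (u * v))
    where
    eq : ∀ w → 0ℤ ≡ 1ℤ * (+ 2 * w * 0ℤ)
    eq = solve-∀
  [3u+v√-6]^even (suc m) = trans
    (cong (λ w → (+ 3 * u , v) ℤ[√-6].⊗ ((+ 3 * u , v) ℤ[√-6].⊗ w)) ([3u+v√-6]^even m))
    (cong₂ _,_ (re u v ((+ 3) ^ℤ m) (L.C m) (L.S m)) (im u v ((+ 3) ^ℤ m) (L.C m) (L.S m)))
    where
    re : ∀ u v t c s →
      + 3 * u * (+ 3 * u * (t * c) + - + 6 * (v * (t * (+ 2 * (u * v) * s))))
        + - + 6 * (v * (+ 3 * u * (t * (+ 2 * (u * v) * s)) + v * (t * c)))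
      ≡ + 3 * t * ((+ 3 * (u * u) - + 2 * (v * v)) * c
          + - (+ 4 * (+ 3 * (u * u)) * (+ 2 * (v * v))) * (1ℤ * s))
    re = solve-∀
    im : ∀ u v t c s →
      + 3 * u * (+ 3 * u * (t * (+ 2 * (u * v) * s)) + v * (t * c))
        + v * (+ 3 * u * (t * c) + - + 6 * (v * (t * (+ 2 * (u * v) * s))))
      ≡ + 3 * t * (+ 2 * (u * v) * ((+ 3 * (u * u) - + 2 * (v * v)) * s + 1ℤ * c))
    im = solve-∀

  im-[3u+v√-6]^odd : ∀ m → proj₂ ((+ 3 * u , v) ℤ[√-6].^^ suc (m ℕ.* 2)) ≡ (+ 3) ^ℤ m * (v * L.L m)
  im-[3u+v√-6]^odd m = trans (cong (λ w → proj₂ ((+ 3 * u , v) ℤ[√-6].⊗ w)) ([3u+v√-6]^even m))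
    (trans (im u v ((+ 3) ^ℤ m) (L.C m) (L.S m)) (cong (λ l → (+ 3) ^ℤ m * (v * l)) (sym (L.L-def m))))
    where
    im : ∀ u v t c s → + 3 * u * (t * (+ 2 * (u * v) * s)) + v * (t * c)
                       ≡ t * (v * (c + + 2 * (+ 3 * (u * u)) * s))
    im = solve-∀

  frobenius : ∀ m → Prime (suc (m ℕ.* 2)) → + suc (m ℕ.* 2) ∣ v * L.L m →
              + suc (m ℕ.* 2) ∣ v ^ℤ suc (m ℕ.* 2) * (- + 6) ^ℤ m
  frobenius m pr n∣d = ∣-lin₂ ((+ 3) ^ℤ m) (- 1ℤ) n∣d
    (subst (λ w → _ ∣ w - z) (im-[3u+v√-6]^odd m) (ℤ[√-6].im-frobenius (+ 3 * u) v m pr))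
    (eq ((+ 3) ^ℤ m) (v * L.L m) z)
    where
    z = v ^ℤ suc (m ℕ.* 2) * (- + 6) ^ℤ m
    eq : ∀ t w z → z ≡ t * w + - 1ℤ * (t * w - z)
    eq = solve-∀

  -- Modulo 3, `P u` and `D` vanish and `- Q v ≡ v² ≡ 1`, so `C ≡ 1` and `2 P S` drops out. This
  -- congruence later decides the sign of `L`.
  L-mod-3 : ¬ + 3 ∣ v → ∀ m → + 3 ∣ L.L m - 1ℤ
  L-mod-3 3∤v m with 3∣⊎3∣z²-1 v
  ... | inj₁ 3∣v = contradiction 3∣v 3∤v
  ... | inj₂ 3∣v²-1 = subst (λ l → + 3 ∣ l - 1ℤ) (sym (L.L-def m))
    (∣-lin₂ 1ℤ (+ 2 * (u * u) * L.S m) (L.C≡1 3∣c-1 3∣D m) ∣-refl (eq u (L.C m) (L.S m)))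
    where
    3∣c-1 : + 3 ∣ P u - Q v - 1ℤ
    3∣c-1 = ∣-lin₂ (- + 2) (u * u - 1ℤ) 3∣v²-1 ∣-refl (expand u v)
      where
      expand : ∀ u v → + 3 * (u * u) - + 2 * (v * v) - 1ℤ ≡ - + 2 * (v * v - 1ℤ) + (u * u - 1ℤ) * + 3
      expand = solve-∀
    3∣D : + 3 ∣ L.D
    3∣D = divides (- (+ 8 * (u * u) * (v * v))) (expand u v)
      where
      expand : ∀ u v → - (+ 4 * (+ 3 * (u * u)) * (+ 2 * (v * v))) ≡ - (+ 8 * (u * u) * (v * v)) * + 3
      expand = solve-∀
    eq : ∀ u c s → c + + 2 * (+ 3 * (u * u)) * s - 1ℤ ≡ 1ℤ * (c - 1ℤ) + + 2 * (u * u) * s * + 3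
    eq = solve-∀

  module _ (8∣u²-1 : + 8 ∣ u * u - 1ℤ) where

    2∣c-1 : + 2 ∣ P u - Q v - 1ℤ
    2∣c-1 = ∣-lin₂ (+ 3) (1ℤ - v * v) (∣-trans (divides (+ 4) refl) 8∣u²-1) ∣-refl (expand u v)
      where
      expand : ∀ u v → + 3 * (u * u) - + 2 * (v * v) - 1ℤ ≡ + 3 * (u * u - 1ℤ) + (1ℤ - v * v) * + 2
      expand = solve-∀

    8∣D : + 8 ∣ L.D
    8∣D = divides (- (+ 3 * (u * u) * (v * v))) (expand u v)
      where
      expand : ∀ u v → - (+ 4 * (+ 3 * (u * u)) * (+ 2 * (v * v))) ≡ - (+ 3 * (u * u) * (v * v)) * + 8
      expand = solve-∀

    L-odd : ∀ m → ¬ + 2 ∣ L.L m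
    L-odd m 2∣L = prime-∤1 prime-2 (∣-lin₃ 1ℤ (- 1ℤ) (- (P u * L.S m))
      (subst (+ 2 ∣_) (L.L-def m) 2∣L) (L.C≡1 2∣c-1 (∣-trans (divides (+ 4) refl) 8∣D) m) ∣-refl
      (eq (P u) (L.C m) (L.S m)))
      where
      eq : ∀ p c s → 1ℤ ≡ 1ℤ * (c + + 2 * p * s) + - 1ℤ * (c - 1ℤ) + - (p * s) * + 2
      eq = solve-∀

    -- For odd `u` and `v`, `3u² - 2v² - 1 ≡ 3 - 2 - 1 = 0` modulo 8, which supplies the condition
    -- modulo 4 in `L≢1`.
    L≢1-odd : ¬ + 2 ∣ v → ∀ m → 0 ℕ.< m → L.L m ≢ 1ℤ
    L≢1-odd 2∤v with 2∣⊎8∣z²-1 v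
    ... | inj₁ 2∣v = contradiction 2∣v 2∤v
    ... | inj₂ 8∣v²-1 = L≢1 {P u} {Q v} 2∣p-1 4∣c-1 8∣D
      where
      2∣p-1 : + 2 ∣ P u - 1ℤ
      2∣p-1 = ∣-lin₂ (+ 3) 1ℤ (∣-trans (divides (+ 4) refl) 8∣u²-1) ∣-refl (expand u)
        where
        expand : ∀ u → + 3 * (u * u) - 1ℤ ≡ + 3 * (u * u - 1ℤ) + 1ℤ * + 2
        expand = solve-∀
      4∣c-1 : + 4 ∣ P u - Q v - 1ℤ
      4∣c-1 = ∣-trans {+ 4} {+ 8} (divides (+ 2) refl) (∣-lin₂ (+ 3) (- + 2) 8∣u²-1 8∣v²-1 (expand u v))
        where
        expand : ∀ u v → + 3 * (u * u) - + 2 * (v * v) - 1ℤ ≡ + 3 * (u * u - 1ℤ) + - + 2 * (v * v - 1ℤ)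
        expand = solve-∀

L-injective′ : ∀ p₁ p₂ q → + 4 ∣ p₁ - p₂ → + 2 ∣ p₁ - q - 1ℤ → + 2 ∣ p₂ - q - 1ℤ →
  ∀ m → 0 ℕ.< m → Lehmer.L p₁ q m ≡ Lehmer.L p₂ q m → p₁ ≡ p₂
L-injective′ p₁ p₂ q 4∣δ 2∣c₁ 2∣c₂ m 0<m L≡ = ℤ.i-j≡0⇒i≡j p₁ p₂
  (L-injective q p₂ (p₁ - p₂) 4∣δ (subst (λ p → + 2 ∣ p - q - 1ℤ) p₁≡ 2∣c₁) 2∣c₂ m 0<m
    (trans (cong (λ p → Lehmer.L p q m) (sym p₁≡)) L≡))
  where
  split : ∀ a b → a ≡ b + (a - b)
  split = solve-∀
  p₁≡ : p₁ ≡ p₂ + (p₁ - p₂)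
  p₁≡ = split p₁ p₂

-- The value of `v²` or `L²` for a prime power `d`.

module _ {m r ℓ : ℕ} (n-prime : Prime (suc (m ℕ.* 2))) (n≢2 : suc (m ℕ.* 2) ≢ 2) (0<m : 0 ℕ.< m)
         (ℓ-prime : Prime ℓ) (3∤d : ¬ + 3 ∣ + (ℓ ℕ.^ suc r)) where
  private
    n : ℕ
    n = suc (m ℕ.* 2)
    d : ℤ
    d = + (ℓ ℕ.^ suc r)

  ℓ∣d : + ℓ ∣ d
  ℓ∣d = ∣ᵤ⇒∣ (ℕ.m∣m*n (ℓ ℕ.^ r))

  ℓ≢3 : ℓ ≢ 3
  ℓ≢3 refl = 3∤d ℓ∣d

  module _ (u v : ℤ) (d≡ : + (ℓ ℕ.^ suc r) ≡ v * Lehmer.L (P u) (Q v) m)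
           (8∣u²-1 : + 8 ∣ u * u - 1ℤ) (3∤v : ¬ + 3 ∣ v)
           (coprime : ∀ {p} → Prime p → + p ∣ v → ¬ + p ∣ u) where
    private
      L : ℤ
      L = Lehmer.L (P u) (Q v) m

    abs≡ : abs v ℕ.* abs L ≡ ℓ ℕ.^ suc r
    abs≡ = trans (sym (ℤ.abs-* v L)) (sym (cong abs d≡))

    3∣L-1 : + 3 ∣ L - 1ℤ
    3∣L-1 = L-mod-3 u v 3∤v m

    abs-L≡1 : ¬ + ℓ ∣ L → abs L ≡ 1
    abs-L≡1 ℓ∤L = prime-power-coprime-factor ℓ-prime (suc r) (abs L) (abs v)
      (trans (ℕ.*-comm (abs L) (abs v)) abs≡) (λ h → ℓ∤L (∣ᵤ⇒∣ h))

    ∤P^m : ∀ {p} → Prime p → p ≢ 3 → + p ∣ v → ¬ + p ∣ P u ^ℤ m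
    ∤P^m pr p≢3 p∣v h with prime-∣* pr (+ 3) (u * u) (prime-∣^ pr (P u) m h)
    ... | inj₁ p∣3 = p≢3 (prime∣prime pr prime-3 p∣3)
    ... | inj₂ p∣u² = coprime pr p∣v (prime-∣² pr u p∣u²)

    L²≡1 : ℓ ≡ 2 → L * L ≡ 1ℤ
    L²≡1 refl = trans (square-abs L) (cong (λ a → + (a ℕ.* a)) (abs-L≡1 (L-odd u v 8∣u²-1 m)))

    -- `n ∣ d` gives `n ∣ vⁿ (-6)ᵐ` by `frobenius`, and `n` does not divide 6: it is not 2, and
    -- `n = ℓ = 3` would contradict `3∤d`.
    n∣v : ℓ ≡ n → + n ∣ v
    n∣v ℓ≡n = [ prime-∣^ n-prime v n , (λ n∣6ᵐ → contradiction (prime-∣^ n-prime (- + 6) m n∣6ᵐ) n∤6) ]′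
      (prime-∣* n-prime (v ^ℤ n) ((- + 6) ^ℤ m)
        (frobenius u v m n-prime (subst (+ n ∣_) d≡ (subst (λ p → + p ∣ d) ℓ≡n ℓ∣d))))
      where
      n∤6 : ¬ + n ∣ - + 6
      n∤6 n∣6 = [ (λ n∣-2 → n≢2 (prime∣prime n-prime prime-2 (∣m⇒∣-m {i = + n} {m = - + 2} n∣-2)))
                , (λ n∣3 → ℓ≢3 (trans ℓ≡n (prime∣prime n-prime prime-3 n∣3))) ]′
                (prime-∣* n-prime (- + 2) (+ 3) n∣6)

    module _ (ℓ≡n : ℓ ≡ n) where

      n≢3 : n ≢ 3
      n≢3 n≡3 = ℓ≢3 (trans ℓ≡n n≡3)

      n∣v²-multiple : + n * + n ∣ Q v
      n∣v²-multiple = from (n∣v ℓ≡n)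
        where
        from : + n ∣ v → + n * + n ∣ Q v
        from (divides w v≡) = divides (+ 2 * (w * w)) (trans (cong Q v≡) (expand w (+ n)))
          where
          expand : ∀ w n → + 2 * (w * n * (w * n)) ≡ + 2 * (w * w) * (n * n)
          expand = solve-∀

      n²∣L-nPᵐ : + n * + n ∣ L - + n * P u ^ℤ m
      n²∣L-nPᵐ = ∣-trans n∣v²-multiple (Lehmer.L-mod-q (P u) (Q v) m)

      n∣L : + n ∣ L
      n∣L = ∣-lin₂ 1ℤ (P u ^ℤ m) (∣-trans (divides (+ n) refl) n²∣L-nPᵐ) ∣-refl
        (expand L (+ n) (P u ^ℤ m))
        where
        expand : ∀ l n z → l ≡ 1ℤ * (l - n * z) + z * n
        expand = solve-∀

      -- Because `n ∣ v`, the congruence `L ≡ n Pᵐ` holds modulo `n²`. So `n² ∣ L` would force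
      -- `n ∣ Pᵐ`, although `n` is not 3 and does not divide `u`.
      n²∤L : ¬ + n * + n ∣ L
      n²∤L n²∣L = ∤P^m n-prime n≢3 (n∣v ℓ≡n) (*-cancelˡ-∣ (+ n) {{prime⇒nonZero n-prime}}
        (∣-lin₂ 1ℤ (- 1ℤ) n²∣L n²∣L-nPᵐ (expand L (+ n * P u ^ℤ m))))
        where
        expand : ∀ l z → z ≡ 1ℤ * l + - 1ℤ * (l - z)
        expand = solve-∀

      abs-L≡n : abs L ≡ n
      abs-L≡n = from (∣⇒∣ᵤ n∣L)
        where
        from : n ℕ.∣ abs L → abs L ≡ n
        from (ℕ.divides a abs-L≡) = trans abs-L≡ (trans (cong (ℕ._* n) a≡1) (ℕ.*-identityˡ n))
          where
          a·v≡ : a ℕ.* abs v ≡ n ℕ.^ r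
          a·v≡ = ℕ.*-cancelˡ-≡ (a ℕ.* abs v) (n ℕ.^ r) n {{prime⇒nonZero n-prime}}
            (trans (sym (ℕ.*-assoc n a (abs v)))
            (trans (cong (ℕ._* abs v) (trans (ℕ.*-comm n a) (sym abs-L≡)))
            (trans (ℕ.*-comm (abs L) (abs v))
            (trans abs≡ (cong (ℕ._^ suc r) ℓ≡n)))))
          n∤a : ¬ n ℕ.∣ a
          n∤a n∣a = n²∤L (∣ᵤ⇒∣
            (subst₂ ℕ._∣_ (sym (ℤ.abs-* (+ n) (+ n))) (sym abs-L≡) (ℕ.*-monoˡ-∣ n n∣a)))
          a≡1 : a ≡ 1
          a≡1 = prime-power-coprime-factor n-prime r a (abs v) a·v≡ n∤a

      L²≡n² : L * L ≡ + (n ℕ.* n)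
      L²≡n² = trans (square-abs L) (cong (λ a → + (a ℕ.* a)) abs-L≡n)

    -- If `ℓ ∣ v`, then `L ≡ n Pᵐ` is nonzero modulo `ℓ`, so `L = ±1`, and both signs are excluded.
    -- The 2-adic exclusion of 1 requires `v` odd, which holds because `d` is odd.
    v²≡1 : ℓ ≢ 2 → ℓ ≢ n → v * v ≡ 1ℤ
    v²≡1 ℓ≢2 ℓ≢n = trans (square-abs v) (cong (λ a → + (a ℕ.* a))
      (prime-power-coprime-factor ℓ-prime (suc r) (abs v) (abs L) abs≡ (λ h → ℓ∤v (∣ᵤ⇒∣ h))))
      where
      2∤v : ¬ + 2 ∣ v
      2∤v 2∣v = ℓ≢2 (sym (prime∣prime prime-2 ℓ-prime
        (prime-∣^ prime-2 (+ ℓ) (suc r)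
          (subst (+ 2 ∣_) (trans (sym d≡) (pos-^ ℓ (suc r))) (∣m⇒∣m*n L 2∣v)))))
        where
        pos-^ : ∀ a k → + (a ℕ.^ k) ≡ (+ a) ^ℤ k
        pos-^ a zero    = refl
        pos-^ a (suc k) = trans (ℤ.pos-* a (a ℕ.^ k)) (cong (+ a *_) (pos-^ a k))
      module _ (ℓ∣v : + ℓ ∣ v) where
        ℓ∤L : ¬ + ℓ ∣ L
        ℓ∤L ℓ∣L = [ (λ ℓ∣n → ℓ≢n (prime∣prime ℓ-prime n-prime ℓ∣n)) , ∤P^m ℓ-prime ℓ≢3 ℓ∣v ]′
          (prime-∣* ℓ-prime (+ n) (P u ^ℤ m)
            (∣-lin₂ 1ℤ (- 1ℤ) ℓ∣L
              (∣-trans (∣n⇒∣m*n (+ 2) (∣m⇒∣m*n v ℓ∣v)) (Lehmer.L-mod-q (P u) (Q v) m))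
              (expand L (+ n * P u ^ℤ m))))
          where
          expand : ∀ l z → z ≡ 1ℤ * l + - 1ℤ * (l - z)
          expand = solve-∀
        L≢-1 : L ≢ - 1ℤ
        L≢-1 L≡-1 with () ← prime∣prime prime-3 prime-2
          (∣m⇒∣-m {i = + 3} {m = - + 2} (subst (λ l → + 3 ∣ l - 1ℤ) L≡-1 3∣L-1))
        absurd : ⊥
        absurd = [ L≢1-odd u v 8∣u²-1 2∤v m 0<m , L≢-1 ]′
          (square-injective L 1ℤ (trans (square-abs L) (cong (λ a → + (a ℕ.* a)) (abs-L≡1 ℓ∤L))))
      ℓ∤v : ¬ + ℓ ∣ v
      ℓ∤v = absurd

-- Comparison of two solutions.

record Factorisation (m : ℕ) (d y : ℤ) : Set where
  field
    u v : ℤ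
    y≡ : y ≡ P u + Q v
    d≡ : d ≡ v * Lehmer.L (P u) (Q v) m
    8∣u²-1 : + 8 ∣ u * u - 1ℤ
    3∤v : ¬ + 3 ∣ v
    coprime : ∀ {p} → Prime p → + p ∣ v → ¬ + p ∣ u

representation⇒factorisation : ∀ {m d y} → ¬ + 3 ∣ y → Unit y (+ 2) → Unit y d →
                               Representation m d y → Factorisation m d y
representation⇒factorisation {m} {d} {y} 3∤y unit-2 unit-d
  record { u = u ; v = v ; y≡ = y≡ ; d≡ = d≡ } = record
  { u = u ; v = v ; y≡ = y≡ ; d≡ = d≡
  ; 8∣u²-1 = [ (λ 2∣u → contradiction (2∣y 2∣u) (prime-∤unit prime-2 y (+ 2) unit-2 ∣-refl))
             , id ]′ (2∣⊎8∣z²-1 u)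
  ; 3∤v = λ 3∣v → 3∤y (subst (+ 3 ∣_) (sym y≡) (∣-lin₂ (u * u) (+ 2 * v) ∣-refl 3∣v (expand₃ u v)))
  ; coprime = λ {p} pr p∣v p∣u → prime-∤unit pr y d unit-d
      (subst (+ p ∣_) (sym d≡) (∣m⇒∣m*n (Lehmer.L (P u) (Q v) m) p∣v))
      (subst (+ p ∣_) (sym y≡) (∣-lin₂ (+ 3 * u) (+ 2 * v) p∣u p∣v (expand u v)))
  }
  where
  2∣y : + 2 ∣ u → + 2 ∣ y
  2∣y 2∣u = subst (+ 2 ∣_) (sym y≡) (∣-lin₂ (+ 3 * u) (v * v) 2∣u ∣-refl (expand₂ u v))
    where
    expand₂ : ∀ u v → + 3 * (u * u) + + 2 * (v * v) ≡ + 3 * u * u + v * v * + 2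
    expand₂ = solve-∀
  expand₃ : ∀ u v → + 3 * (u * u) + + 2 * (v * v) ≡ u * u * + 3 + + 2 * v * v
  expand₃ = solve-∀
  expand : ∀ u v → + 3 * (u * u) + + 2 * (v * v) ≡ + 3 * u * u + + 2 * v * v
  expand = solve-∀

factorisation : ∀ m x d y → (∃ λ k → y ≡ + suc k) → ¬ + 3 ∣ y → ¬ + 3 ∣ d → Unit y x →
                N₃₂ x d ≡ y ^ℤ suc (m ℕ.* 2) → Factorisation m d y
factorisation m x d y 0<y 3∤y 3∤d ux eq = representation⇒factorisation 3∤y
  (unit-2 m x d y 0<y 3∤y 3∤d ux eq) (unit-d m x d y 0<y 3∤y 3∤d ux eq)
  (representation m x d y 0<y 3∤y 3∤d ux eq)

product-cancel : ∀ a b c d → a * b ≡ c * d → a ≡ c → a ≢ 0ℤ → b ≡ d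
product-cancel a b c d eq refl a≢0 = ℤ.*-cancelˡ-≡ a b d {{≢-nonZero a≢0}} eq

3∤2 : ¬ + 3 ∣ + 2
3∤2 3∣2 with () ← prime∣prime prime-3 prime-2 3∣2

∤⇒≢0 : ∀ {k z} → ¬ k ∣ z → z ≢ 0ℤ
∤⇒≢0 k∤z refl = k∤z (divides 0ℤ refl)

module _ {m r ℓ : ℕ} (n-prime : Prime (suc (m ℕ.* 2))) (n≢2 : suc (m ℕ.* 2) ≢ 2) (0<m : 0 ℕ.< m)
         (ℓ-prime : Prime ℓ) (3∤d : ¬ + 3 ∣ + (ℓ ℕ.^ suc r)) {y₁ y₂ : ℤ}
         (f₁ : Factorisation m (+ (ℓ ℕ.^ suc r)) y₁) (f₂ : Factorisation m (+ (ℓ ℕ.^ suc r)) y₂) where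
  private
    module F₁ = Factorisation f₁
    module F₂ = Factorisation f₂
    module L₁ = Lehmer (P F₁.u) (Q F₁.v)
    module L₂ = Lehmer (P F₂.u) (Q F₂.v)

  product-of-squares : (F₁.v * F₁.v) * (L₁.L m * L₁.L m) ≡ (F₂.v * F₂.v) * (L₂.L m * L₂.L m)
  product-of-squares = trans (square F₁.v (L₁.L m))
    (trans (cong₂ _*_ vL≡ vL≡) (sym (square F₂.v (L₂.L m))))
    where
    vL≡ : F₁.v * L₁.L m ≡ F₂.v * L₂.L m
    vL≡ = trans (sym F₁.d≡) F₂.d≡
    square : ∀ v l → v * v * (l * l) ≡ v * l * (v * l)
    square = solve-∀

  L²-equal⇒v²-equal : L₁.L m * L₁.L m ≡ L₂.L m * L₂.L m → F₁.v * F₁.v ≡ F₂.v * F₂.v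
  L²-equal⇒v²-equal L²≡ = product-cancel (L₁.L m * L₁.L m) (F₁.v * F₁.v) (L₂.L m * L₂.L m) (F₂.v * F₂.v)
    (trans (ℤ.*-comm (L₁.L m * L₁.L m) (F₁.v * F₁.v))
      (trans product-of-squares (ℤ.*-comm (F₂.v * F₂.v) (L₂.L m * L₂.L m)))) L²≡
    (*-≢0 (L₁.L m) (L₁.L m) L≢0 L≢0)
    where
    L≢0 : L₁.L m ≢ 0ℤ
    L≢0 = ∤⇒≢0 (L-odd F₁.u F₁.v F₁.8∣u²-1 m)

  v²-equal : F₁.v * F₁.v ≡ F₂.v * F₂.v
  v²-equal with ℓ ℕ.≟ 2 | ℓ ℕ.≟ suc (m ℕ.* 2)
  ... | yes ℓ≡2 | _ = L²-equal⇒v²-equal (trans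
    (L²≡1 {r = r} n-prime n≢2 0<m ℓ-prime 3∤d F₁.u F₁.v F₁.d≡ F₁.8∣u²-1 F₁.3∤v F₁.coprime ℓ≡2)
    (sym (L²≡1 {r = r} n-prime n≢2 0<m ℓ-prime 3∤d F₂.u F₂.v F₂.d≡ F₂.8∣u²-1 F₂.3∤v F₂.coprime ℓ≡2)))
  ... | no _ | yes ℓ≡n = L²-equal⇒v²-equal (trans
    (L²≡n² {r = r} n-prime n≢2 0<m ℓ-prime 3∤d F₁.u F₁.v F₁.d≡ F₁.8∣u²-1 F₁.3∤v F₁.coprime ℓ≡n)
    (sym (L²≡n² {r = r} n-prime n≢2 0<m ℓ-prime 3∤d F₂.u F₂.v F₂.d≡ F₂.8∣u²-1 F₂.3∤v F₂.coprime ℓ≡n)))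
  ... | no ℓ≢2 | no ℓ≢n = trans
    (v²≡1 {r = r} n-prime n≢2 0<m ℓ-prime 3∤d F₁.u F₁.v F₁.d≡ F₁.8∣u²-1 F₁.3∤v F₁.coprime ℓ≢2 ℓ≢n)
    (sym (v²≡1 {r = r} n-prime n≢2 0<m ℓ-prime 3∤d F₂.u F₂.v F₂.d≡ F₂.8∣u²-1 F₂.3∤v F₂.coprime ℓ≢2 ℓ≢n))

  Q-equal : Q F₁.v ≡ Q F₂.v
  Q-equal = cong (+ 2 *_) v²-equal

  -- Equal `v²` only gives equal `L²`. Both values of `L` are 1 modulo 3, so opposite signs would
  -- give `3 ∣ 2`.
  L-equal : L₁.L m ≡ L₂.L m
  L-equal = [ id , (λ L₁≡-L₂ → ⊥-elim (opposite L₁≡-L₂)) ]′ (square-injective (L₁.L m) (L₂.L m)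
    (product-cancel (F₁.v * F₁.v) (L₁.L m * L₁.L m) (F₂.v * F₂.v) (L₂.L m * L₂.L m)
      product-of-squares v²-equal (*-≢0 F₁.v F₁.v (∤⇒≢0 F₁.3∤v) (∤⇒≢0 F₁.3∤v))))
    where
    two : ∀ l → + 2 ≡ - 1ℤ * (- l - 1ℤ) + - 1ℤ * (l - 1ℤ)
    two = solve-∀
    opposite : L₁.L m ≢ - L₂.L m
    opposite L₁≡-L₂ = 3∤2 (∣-lin₂ (- 1ℤ) (- 1ℤ)
      (subst (λ l → + 3 ∣ l - 1ℤ) L₁≡-L₂ (L-mod-3 F₁.u F₁.v F₁.3∤v m))
      (L-mod-3 F₂.u F₂.v F₂.3∤v m) (two (L₂.L m)))

  -- Both `u²` are 1 modulo 8, so the two values of `P` differ by a multiple of 8. This provides the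
  -- condition modulo 4 of `L-injective′`.
  P-equal : P F₁.u ≡ P F₂.u
  P-equal = L-injective′ (P F₁.u) (P F₂.u) (Q F₁.v)
    (∣-trans {+ 4} {+ 8} (divides (+ 2) refl)
      (∣-lin₂ (+ 3) (- + 3) F₁.8∣u²-1 F₂.8∣u²-1 (expand F₁.u F₂.u)))
    (2∣c-1 F₁.u F₁.v F₁.8∣u²-1)
    (subst (λ q → + 2 ∣ P F₂.u - q - 1ℤ) (sym Q-equal) (2∣c-1 F₂.u F₂.v F₂.8∣u²-1))
    m 0<m (trans L-equal (cong (λ q → Lehmer.L (P F₂.u) q m) (sym Q-equal)))
    where
    expand : ∀ u₁ u₂ → + 3 * (u₁ * u₁) - + 3 * (u₂ * u₂) ≡ + 3 * (u₁ * u₁ - 1ℤ) + - + 3 * (u₂ * u₂ - 1ℤ)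
    expand = solve-∀

  y-equal : y₁ ≡ y₂
  y-equal = trans F₁.y≡ (trans (cong₂ _+_ P-equal Q-equal) (sym F₂.y≡))

-- From the equation to a factorisation of `d`.

-- `3 ∣ y` forces `3 ∣ d`. Then 9 divides `y² z` and `2d²`, hence `3x²`. The shape `y * (y * z)` is
-- what a power of exponent at least 2 unfolds to.
3∣y⇒3∣x : ∀ x d y z → N₃₂ x d ≡ y * (y * z) → + 3 ∣ y → + 3 ∣ x
3∣y⇒3∣x x d y z eq (divides b y≡) = from ([ (λ 3∣2 → contradiction 3∣2 3∤2)
    , prime-∣² prime-3 d ]′
    (prime-∣* prime-3 (+ 2) (d * d) (∣-lin₂ (y * z) (- (x * x)) (divides b y≡) ∣-refl
      (trans (split x d) (cong (λ w → w + - (x * x) * + 3) (trans eq (swap y z)))))))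
  where
  split : ∀ x d → + 2 * (d * d) ≡ + 3 * (x * x) + + 2 * (d * d) + - (x * x) * + 3
  split = solve-∀
  swap : ∀ y z → y * (y * z) ≡ y * z * y
  swap = solve-∀
  isolate : ∀ x d → + 3 * (x * x) ≡ + 3 * (x * x) + + 2 * (d * d) - + 2 * (d * d)
  isolate = solve-∀
  collect : ∀ b c z → b * + 3 * (b * + 3 * z) - + 2 * (c * + 3 * (c * + 3))
                      ≡ + 3 * ((b * b * z - + 2 * (c * c)) * + 3)
  collect = solve-∀
  from : + 3 ∣ d → + 3 ∣ x
  from (divides c d≡) = prime-∣² prime-3 x (
    (divides (b * b * z - + 2 * (c * c)) (ℤ.*-cancelˡ-≡ (+ 3) (x * x) ((b * b * z - + 2 * (c * c)) * + 3)
      (trans (isolate x d) (trans (cong (_- + 2 * (d * d)) eq)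
        (trans (cong₂ (λ y d → y * (y * z) - + 2 * (d * d)) y≡ d≡) (collect b c z)))))))

module _ (m x d y : ℕ) (0<m : 0 ℕ.< m) (solution : IsSolution (suc (m ℕ.* 2)) d x y) where

  unit-x : Unit (+ y) (+ x)
  unit-x = gcd≡1⇒unit x y (proj₁ (proj₂ (proj₂ solution)))

  norm≡ : N₃₂ (+ x) (+ d) ≡ (+ y) ^ℤ suc (m ℕ.* 2)
  norm≡ = trans (expand (+ x) (+ d)) (proj₂ (proj₂ (proj₂ solution)))
    where
    expand : ∀ x d → + 3 * (x * x) + + 2 * (d * d)
      ≡ (x - d) * ((x - d) * 1ℤ) + x * (x * 1ℤ) + (x + d) * ((x + d) * 1ℤ)
    expand = solve-∀

  positive : ∃ λ k → + y ≡ + suc k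
  positive = from (proj₁ (proj₂ solution))
    where
    from : ∀ {y} → 0 ℕ.< y → ∃ λ k → + y ≡ + suc k
    from {suc k} _ = k , refl

  3∤y : ¬ + 3 ∣ + y
  3∤y 3∣y = prime-∤unit prime-3 (+ y) (+ x) unit-x (from 0<m norm≡) 3∣y
    where
    from : ∀ {m} → 0 ℕ.< m → N₃₂ (+ x) (+ d) ≡ (+ y) ^ℤ suc (m ℕ.* 2) → + 3 ∣ + x
    from {suc m} _ eq = 3∣y⇒3∣x (+ x) (+ d) (+ y) ((+ y) ^ℤ suc (m ℕ.* 2)) eq 3∣y

  3∤d : ¬ + 3 ∣ + d
  3∤d 3∣d = 3∤y (prime-∣^ prime-3 (+ y) (suc (m ℕ.* 2))
    (subst (+ 3 ∣_) norm≡ (∣-lin₂ (+ x * + x) (+ 2 * + d) ∣-refl 3∣d (expand (+ x) (+ d)))))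
    where
    expand : ∀ x d → + 3 * (x * x) + + 2 * (d * d) ≡ x * x * + 3 + + 2 * d * d
    expand = solve-∀

  solution⇒factorisation : Factorisation m (+ d) (+ y)
  solution⇒factorisation = factorisation m (+ x) (+ d) (+ y) positive 3∤y 3∤d unit-x norm≡

-- The bound `0 < m` matters: `L 0 = 1` for every `p`, so `L≢1` and `L-injective` both fail at
-- `m = 0`.
odd-prime : ∀ {n} → Prime n → n ≢ 2 → ∃ λ m → n ≡ suc (m ℕ.* 2) × 0 ℕ.< m
odd-prime {n} n-prime n≢2 with even⊎odd n
... | inj₁ (k , n≡) with prime⇒irreducible n-prime (ℕ.divides k n≡)
...   | inj₂ 2≡n = contradiction (sym 2≡n) n≢2
odd-prime n-prime n≢2 | inj₂ (zero , refl) = contradiction (∣-refl {1ℤ}) (prime-∤1 n-prime)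
odd-prime n-prime n≢2 | inj₂ (suc m , n≡) = suc m , n≡ , ℕ.s≤s ℕ.z≤n

positive-root : ∀ x₁ x₂ → 0 ℕ.< x₁ → 0 ℕ.< x₂ → + x₁ * + x₁ ≡ + x₂ * + x₂ → x₁ ≡ x₂
positive-root (suc a) (suc b) _ _ eq =
  [ ℤ.+-injective , (λ ()) ]′ (square-injective (+ suc a) (+ suc b) eq)

theorem1p2 : (n p r : ℕ) → Prime n → n ≢ 2 → Prime p → 0 < r →
    (x₁ y₁ x₂ y₂ : ℕ) →
    IsSolution n (p ^ r) x₁ y₁ → IsSolution n (p ^ r) x₂ y₂ →
    (x₁ ≡ x₂) × (y₁ ≡ y₂)
theorem1p2 n p (suc r) n-prime n≢2 p-prime _ x₁ y₁ x₂ y₂ s₁ s₂ with odd-prime n-prime n≢2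
... | m , refl , 0<m = positive-root x₁ x₂ (proj₁ s₁) (proj₁ s₂) x²≡ , ℤ.+-injective y≡
  where
  d = p ℕ.^ suc r
  y≡ : + y₁ ≡ + y₂
  y≡ = y-equal {r = r} n-prime n≢2 0<m p-prime (3∤d m x₁ d y₁ 0<m s₁)
         (solution⇒factorisation m x₁ d y₁ 0<m s₁) (solution⇒factorisation m x₂ d y₂ 0<m s₂)
  x²≡ : + x₁ * + x₁ ≡ + x₂ * + x₂
  x²≡ = ℤ.*-cancelˡ-≡ (+ 3) (+ x₁ * + x₁) (+ x₂ * + x₂)
    (Algebra.Properties.AbelianGroup.∙-cancelʳ ℤ.+-0-abelianGroup
      (+ 2 * (+ d * + d)) (+ 3 * (+ x₁ * + x₁)) (+ 3 * (+ x₂ * + x₂))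
      (trans (norm≡ m x₁ d y₁ 0<m s₁) (trans (cong (_^ℤ suc (m ℕ.* 2)) y≡)
        (sym (norm≡ m x₂ d y₂ 0<m s₂)))))
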